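{- Let $h$ and $k$ be positive integers with $3 \leq h \leq k-1$, and let $A$ be a set of $k$ integers such that $A \cap (-A) = \emptyset$. Then \[|h^{\wedge}_{\pm}A| \geq 2hk - h^2 + 1.\] This lower bound is best possible: for all such $h,k$ there is such a set $A$ attaining equality.
   Context: For a finite set $A = \{a_1, \ldots, a_k\}$ of integers (with distinct $a_i$) and a positive integer $h$, the restricted $h$-fold signed sumset is \[h^{\wedge}_{\pm}A = \left\{ \sum_{i=1}^{k} \lambda_i a_i : \lambda_i \in \{ -1,0,1\}, \ \sum_{i=1}^{k} |\lambda_i| = h \right\}.\] $-A = \{ -a : a \in A\}$. -}

module Defs where

open import Data.Nat using (ℕ; zero; suc)
import Data.Nat as ℕ
open import Data.Integer using (ℤ; _+_; _*_; -_; +_; -1ℤ; 0ℤ; 1ℤ)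
import Data.Integer as ℤ
open import Data.List using (List; []; _∷_; map; concatMap; filter; length; deduplicate)
open import Data.Vec using (Vec; []; _∷_; toList)
open import Data.List.Membership.Propositional using (_∈_; _∉_)
open import Data.List.Relation.Unary.Unique.Propositional using (Unique)
open import Relation.Binary.PropositionalEquality using (_≡_)

data Coef : Set where
  neg zer pos : Coef

coefℤ : Coef → ℤ
coefℤ neg = -1ℤ
coefℤ zer = 0ℤ
coefℤ pos = 1ℤ

absCoef : Coef → ℕ
absCoef zer = 0
absCoef neg = 1
absCoef pos = 1

allCoefs : (k : ℕ) → List (Vec Coef k)
allCoefs zero = [] ∷ []
allCoefs (suc k) = concatMap (λ v → (neg ∷ v) ∷ (zer ∷ v) ∷ (pos ∷ v) ∷ []) (allCoefs k)

weight : ∀ {k} → Vec Coef k → ℕ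
weight [] = 0
weight (c ∷ v) = absCoef c ℕ.+ weight v

combo : ∀ {k} → Vec Coef k → Vec ℤ k → ℤ
combo [] [] = 0ℤ
combo (c ∷ v) (a ∷ as) = coefℤ c * a + combo v as

-- h^∧_± A, as a list (possibly with repetitions)
restrictedSignedSumset : ∀ {k} → ℕ → Vec ℤ k → List ℤ
restrictedSignedSumset {k} h A =
  map (λ v → combo v A) (filter (λ v → weight v ℕ.≟ h) (allCoefs k))

card : List ℤ → ℕ
card xs = length (deduplicate ℤ._≟_ xs)

-- A = {a_1,…,a_k} with distinct a_i, given as a vector
Distinct : ∀ {k} → Vec ℤ k → Set
Distinct A = Unique (toList A)

DisjointFromNeg : ∀ {k} → Vec ℤ k → Set
DisjointFromNeg A = ∀ x → x ∈ toList A → - x ∉ toList A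

{-# OPTIONS --safe #-}
module Submission where

-- Up to sign and order A consists of positive integers a₁ < … < a_k, and shifting by their sum turns signed sums into
-- sums with coefficients in {0, 1, 2} of which exactly j = k − h equal 1; the claim becomes "at least h² + 2hj + 1 values".
-- For j > 1, giving the largest element the coefficient 1 reduces to j − 1, with h new values below and h above.
-- For j = 1 the claim is k² values aᵢ + 2·(subset sum), which is decided by the residues of the aᵢ.
-- Both parities occur: for each parity, take the largest element y of that parity, the k(k−1)/2 + 1 values
-- y + 2·(subset sum of the others), and the elements of that parity below y.
-- All even: halve.
-- All odd: remove the largest element x. Adding 2x exchanges the two residue classes mod 4, so the 2k − 1 new values may be
-- found separately in each class, below the shifted least value of the other class. The induction starts at k = 3, where
-- there are 9 values unless A = {c, 3c, 5c}.
-- The bound is attained by {1, 3, …, 2k − 1}.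

open import Defs
open import Data.Bool using (Bool; true; false; not; _xor_)
import Data.Bool as Bool
open import Data.Bool.Properties using (not-involutive; not-¬; ¬-not; xor-same; xor-identityʳ)
open import Data.Integer using (ℤ; ∣_∣)
import Data.Integer as ℤ
import Data.Integer.Properties as ℤₚ
open import Data.Integer.Tactic.RingSolver using () renaming (solve-∀ to ℤ-solve-∀)
open import Data.List using (List; []; _∷_; _++_; map; length; filter; upTo; deduplicate)
open import Data.List.Membership.Propositional using (_∈_; _∉_)
open import Data.List.Membership.Propositional.Properties
open import Data.List.Properties using (length-map; length-++; length-upTo)
open import Data.List.Relation.Binary.Permutation.Propositional using (_↭_; refl; prep; swap; trans; ↭-sym; ↭⇒↭ₛ)
open import Data.List.Relation.Binary.Permutation.Propositional.Properties using (↭-length; shift; All-resp-↭)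
import Data.List.Relation.Binary.Permutation.Setoid.Properties as ↭ₛ
open import Data.List.Relation.Unary.All as All using (All; []; _∷_)
import Data.List.Relation.Unary.All.Properties as Allₚ
open import Data.List.Relation.Unary.AllPairs as AllPairs using (AllPairs; []; _∷_)
open import Data.List.Relation.Unary.Any as Any using (here; there)
open import Data.List.Relation.Unary.Linked.Properties using (Linked⇒AllPairs)
open import Data.List.Relation.Unary.Unique.DecPropositional.Properties using (deduplicate-!)
open import Data.List.Relation.Unary.Unique.Propositional using (Unique)
import Data.List.Relation.Unary.Unique.Propositional.Properties as Uniqueₚ
open import Data.Nat using (ℕ; zero; suc; _+_; _*_; _∸_; _≤_; _<_; _>_; _≥_; z≤n; s≤s; s≤s⁻¹; ⌊_/2⌋)
import Data.Nat as ℕ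
open import Data.Nat.ListAction using (sum)
open import Data.Nat.Properties hiding (_≟_)
open import Data.Nat.Tactic.RingSolver using (solve-∀)
open import Data.Product using (_×_; Σ; ∃; _,_; proj₁; proj₂)
open import Data.Sum using (_⊎_; inj₁; inj₂)
open import Data.Unit using (⊤; tt)
open import Data.Vec using (Vec; []; _∷_; toList)
open import Data.Vec.Properties using (length-toList)
open import Function using (_∘_; id; case_of_)
open import Relation.Binary.Definitions using (tri<; tri≈; tri>)
open import Relation.Binary.PropositionalEquality using (_≡_; _≢_; refl; sym; cong; cong₂; subst; subst₂; setoid)
open import Relation.Binary.PropositionalEquality using (module ≡-Reasoning) renaming (trans to ≡-trans)
open import Relation.Nullary using (¬_; Dec; yes; no; contradiction)
open import Relation.Nullary.Decidable using (True; toWitness)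
import Algebra.Properties.AbelianGroup ℤₚ.+-0-abelianGroup as ℤ-Group
import Algebra.Properties.CommutativeSemigroup +-commutativeSemigroup as ℕ-Semigroup
import Algebra.Properties.CommutativeSemigroup ℤₚ.+-commutativeSemigroup as ℤ-Semigroup
import Relation.Binary.Construct.Flip.EqAndOrd as Flip
open import Data.List.Sort (Flip.decTotalOrder ≤-decTotalOrder) using (sort; sort-↭; sort-↗)

private
  variable
    P Q R : ℕ → Set
    b h j k m n s x y z : ℕ
    xs ys : List ℕ

-- Lists and families of distinct numbers

extract : {A : Set} {x : A} {xs : List A} → x ∈ xs →
  ∃ λ ys → (xs ↭ x ∷ ys) × (∀ {z} → z ∈ xs → z ≢ x → z ∈ ys)
extract {x = x} x∈xs with ys , zs , refl ← ∈-∃++ x∈xs = ys ++ zs , shift x ys zs , keep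
  where
  keep : ∀ {z} → z ∈ ys ++ x ∷ zs → z ≢ x → z ∈ ys ++ zs
  keep z∈ z≢x with ∈-++⁻ ys z∈
  ... | inj₁ z∈ys          = ∈-++⁺ˡ z∈ys
  ... | inj₂ (here z≡x)    = contradiction z≡x z≢x
  ... | inj₂ (there z∈zs)  = ∈-++⁺ʳ ys z∈zs

unique-⊆⇒length≤ : {A : Set} {xs ys : List A} → Unique xs → (∀ {z} → z ∈ xs → z ∈ ys) → length xs ≤ length ys
unique-⊆⇒length≤ [] _ = z≤n
unique-⊆⇒length≤ (x∉ ∷ u) xs⊆ys with zs , ys↭ , keep ← extract (xs⊆ys (here refl))
  rewrite ↭-length ys↭ =
  s≤s (unique-⊆⇒length≤ u λ z∈ → keep (xs⊆ys (there z∈)) λ { refl → All.lookup x∉ z∈ refl })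

-- Read as "at least `n` numbers satisfy `P`". An explicit list of witnesses lets lower bounds be
-- shifted, glued and extended without `P` being decidable.
Many : ℕ → (ℕ → Set) → Set
Many n P = Σ (List ℕ) λ l → Unique l × All P l × length l ≡ n

many-cast : m ≡ n → Many m P → Many n P
many-cast refl l = l

many-[] : Many 0 P
many-[] = [] , [] , [] , refl

many-list : Unique xs → (∀ {z} → z ∈ xs → P z) → Many (length xs) P
many-list u p = _ , u , All.tabulate p , refl

-- Injectivity is asked only on `P`, because reflections are written with truncated subtraction,
-- which is injective only where nothing is cut off.
many-map : (f : ℕ → ℕ) → (∀ {x y} → P x → P y → f x ≡ f y → x ≡ y) →
  (∀ {x} → P x → Q (f x)) → Many n P → Many n Q
many-map {P} {Q} f inj pq (l , u , p , refl) =
  map f l , unique u p , Allₚ.map⁺ (All.map pq p) , length-map f l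
  where
  unique : ∀ {l} → Unique l → All P l → Unique (map f l)
  unique [] [] = []
  unique (x∉ ∷ u) (px ∷ p) =
    Allₚ.map⁺ (All.zipWith (λ (x≢y , py) fx≡fy → x≢y (inj px py fx≡fy)) (x∉ , p)) ∷ unique u p

many-weaken : (∀ {x} → P x → Q x) → Many n P → Many n Q
many-weaken pq (l , u , p , e) = l , u , All.map pq p , e

many-++ : (∀ {x} → P x → R x) → (∀ {x} → Q x → R x) → (∀ {x} → P x → ¬ Q x) →
  Many m P → Many n Q → Many (m + n) R
many-++ pr qr disjoint (l , u , p , refl) (l′ , u′ , q , refl) =
  l ++ l′ ,
  Uniqueₚ.++⁺ u u′ (λ (z∈l , z∈l′) → disjoint (All.lookup p z∈l) (All.lookup q z∈l′)) ,
  Allₚ.++⁺ (All.map pr p) (All.map qr q) ,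
  length-++ l

many-insert : P x → Many n (λ y → x ≢ y × P y) → Many (suc n) P
many-insert px (l , u , p , e) = _ ∷ l , All.map proj₁ p ∷ u , px ∷ All.map proj₂ p , cong suc e

-- Listing values in increasing order leaves one comparison per new value instead of one for every
-- pair.
many-cons : b < x → P x → Many n (λ y → x < y × P y) → Many (suc n) (λ y → b < y × P y)
many-cons b<x px l = many-insert (b<x , px)
  (many-weaken (λ (x<y , py) → <⇒≢ x<y , <-trans b<x x<y , py) l)

-- Sums with coefficients 0, 1, 2

-- The coefficients -1, 0, 1 shifted to 0, 1, 2, so that signed sums of xs are shifted by the sum of xs. In Sum j s xs the
-- number j counts the shifted coefficients equal to 1, that is, the elements absent from the signed sum.
mult : Coef → ℕ → ℕ
mult neg x = 0
mult zer x = x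
mult pos x = x + x

ones : Coef → ℕ
ones neg = 0
ones zer = 1
ones pos = 0

data Sum : ℕ → ℕ → List ℕ → Set where
  nil : Sum 0 0 []
  add : ∀ {j j′ s s′ x xs} c → Sum j s xs → ones c + j ≡ j′ → mult c x + s ≡ s′ → Sum j′ s′ (x ∷ xs)

skip : Sum j s xs → Sum j s (x ∷ xs)
skip p = add neg p refl refl

one : Sum j s xs → Sum (suc j) (x + s) (x ∷ xs)
one p = add zer p refl refl

two : Sum j s xs → Sum j (x + x + s) (x ∷ xs)
two p = add pos p refl refl

sum-↭ : xs ↭ ys → Sum j s xs → Sum j s ys
sum-↭ refl p = p
sum-↭ (prep x xs↭) (add c p e f) = add c (sum-↭ xs↭ p) e f
sum-↭ (swap x y xs↭) (add c (add {j = j} {s = s} d p refl refl) refl refl) =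
  add d (add c (sum-↭ xs↭ p) refl refl)
    (ℕ-Semigroup.x∙yz≈y∙xz (ones d) (ones c) j) (ℕ-Semigroup.x∙yz≈y∙xz (mult d y) (mult c x) s)
sum-↭ (trans p q) r = sum-↭ q (sum-↭ p r)

sum-zero : Sum 0 0 xs
sum-zero {[]} = nil
sum-zero {x ∷ xs} = skip sum-zero

sum-ones≤length : Sum j s xs → j ≤ length xs
sum-ones≤length nil = z≤n
sum-ones≤length (add neg p refl _) = m≤n⇒m≤1+n (sum-ones≤length p)
sum-ones≤length (add zer p refl _) = s≤s (sum-ones≤length p)
sum-ones≤length (add pos p refl _) = m≤n⇒m≤1+n (sum-ones≤length p)

sum-one : x ∈ xs → Sum 1 x xs
sum-one {x = x} x∈ with _ , xs↭ , _ ← extract x∈ =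
  sum-↭ (↭-sym xs↭) (add zer sum-zero refl (+-identityʳ x))

sum-two : x ∈ xs → Sum 0 (x + x) xs
sum-two {x = x} x∈ with _ , xs↭ , _ ← extract x∈ =
  sum-↭ (↭-sym xs↭) (add pos sum-zero refl (+-identityʳ (x + x)))

sum-two-one : y ∈ xs → x ∈ xs → x ≢ y → Sum 1 (y + y + x) xs
sum-two-one y∈ x∈ x≢y with _ , xs↭ , keep ← extract y∈ =
  sum-↭ (↭-sym xs↭) (two (sum-one (keep x∈ x≢y)))

sum-two-two-one : z ∈ xs → y ∈ xs → x ∈ xs → y ≢ z → x ≢ z → x ≢ y → Sum 1 (z + z + (y + y + x)) xs
sum-two-two-one z∈ y∈ x∈ y≢z x≢z x≢y with _ , xs↭ , keep ← extract z∈ =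
  sum-↭ (↭-sym xs↭) (two (sum-two-one (keep y∈ y≢z) (keep x∈ x≢z) x≢y))

opposite : Coef → Coef
opposite neg = pos
opposite zer = zer
opposite pos = neg

ones-opposite : ∀ c → ones (opposite c) ≡ ones c
ones-opposite neg = refl
ones-opposite zer = refl
ones-opposite pos = refl

mult-opposite : ∀ c x → mult c x + mult (opposite c) x ≡ x + x
mult-opposite neg x = refl
mult-opposite zer x = refl
mult-opposite pos x = +-identityʳ (x + x)

-- Replacing each coefficient c by 2 - c keeps the ones and complements the value in twice the
-- total; before the shift this is negation of a signed sum.
sum-reflect : Sum j s xs → ∃ λ s′ → Sum j s′ xs × s + s′ ≡ sum xs + sum xs
sum-reflect nil = 0 , nil , refl
sum-reflect {xs = x ∷ xs} (add {j = j} {s = s} c p refl refl) with s′ , p′ , e ← sum-reflect p =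
  mult (opposite c) x + s′ , add (opposite c) p′ (cong (_+ j) (ones-opposite c)) refl , (begin
    mult c x + s + (mult (opposite c) x + s′)   ≡⟨ ℕ-Semigroup.interchange (mult c x) s _ s′ ⟩
    mult c x + mult (opposite c) x + (s + s′)   ≡⟨ cong₂ _+_ (mult-opposite c x) e ⟩
    x + x + (sum xs + sum xs)                   ≡⟨ ℕ-Semigroup.interchange x x _ _ ⟩
    x + sum xs + (x + sum xs)                   ∎)
  where open ≡-Reasoning

-- The values m + t arise from the least value m by raising one of its zero coefficients to 1.
sum-least : Unique xs → ∀ h → h + j ≡ length xs → ∃ λ m →
  Sum j m xs × (∀ {s} → Sum j s xs → m ≤ s) × Many h (λ t → t ∈ xs × Sum (suc j) (m + t) xs)
sum-least {[]} {zero} [] zero refl = 0 , nil , (λ _ → z≤n) , many-[]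
sum-least {x ∷ xs} {suc j} (x∉ ∷ u) zero e
  with m , p , least , _ ← sum-least {j = j} u 0 (suc-injective e) =
  x + m , one p , least′ , many-[]
  where
  -- With `h` zero every coefficient must be 1: any other choice at `x` would need `suc j` ones
  -- among the `j` elements of `xs`.
  least′ : ∀ {s} → Sum (suc j) s (x ∷ xs) → x + m ≤ s
  least′ (add neg q refl refl) = contradiction (sum-ones≤length q) (<⇒≱ (≤-reflexive (cong suc (sym (suc-injective e)))))
  least′ (add zer q refl refl) = +-monoʳ-≤ x (least q)
  least′ (add pos q refl refl) = contradiction (sum-ones≤length q) (<⇒≱ (≤-reflexive (cong suc (sym (suc-injective e)))))
sum-least {x ∷ xs} {j} (x∉ ∷ u) (suc h) e
  with m , p , least , l ← sum-least {j = j} u h (suc-injective e) = go j refl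
  where
  skipped : Many (suc h) (λ t → t ∈ x ∷ xs × Sum (suc j) (m + t) (x ∷ xs))
  skipped = many-insert (here refl , add zer p refl (+-comm x m))
    (many-weaken (λ (t∈ , q) → All.lookup x∉ t∈ , there t∈ , skip q) l)
  go : ∀ i → i ≡ j → ∃ λ m → Sum j m (x ∷ xs) × (∀ {s} → Sum j s (x ∷ xs) → m ≤ s) ×
    Many (suc h) (λ t → t ∈ x ∷ xs × Sum (suc j) (m + t) (x ∷ xs))
  go zero refl = m , skip p , least′ , skipped
    where
    least′ : ∀ {s} → Sum 0 s (x ∷ xs) → m ≤ s
    least′ (add neg q refl refl) = least q
    least′ (add pos q refl refl) = ≤-trans (least q) (m≤n+m _ _)
  go (suc i) refl
    -- Coefficient 2 at `x` is never cheaper than 0, so the least value is the smaller of `m`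
    -- (coefficient 0) and `x + m′` (coefficient 1, one fewer 1 in the tail).
    with m′ , p′ , leastᵢ , l′ ← sum-least {j = i} u (suc h) (≡-trans (sym (+-suc h i)) (suc-injective e))
    with ≤-total m (x + m′)
  ... | inj₁ m≤ = m , skip p , least′ , skipped
    where
    least′ : ∀ {s} → Sum (suc i) s (x ∷ xs) → m ≤ s
    least′ (add neg q refl refl) = least q
    least′ (add zer q refl refl) = ≤-trans m≤ (+-monoʳ-≤ x (leastᵢ q))
    least′ (add pos q refl refl) = ≤-trans (least q) (m≤n+m _ _)
  ... | inj₂ ≤m = x + m′ , one p′ , least′ ,
      many-weaken (λ {t} (t∈ , q) → there t∈ , add zer q refl (sym (+-assoc x m′ t))) l′
    where
    least′ : ∀ {s} → Sum (suc i) s (x ∷ xs) → x + m′ ≤ s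
    least′ (add neg q refl refl) = ≤-trans ≤m (least q)
    least′ (add zer q refl refl) = +-monoʳ-≤ x (leastᵢ q)
    least′ (add pos q refl refl) = ≤-trans ≤m (≤-trans (least q) (m≤n+m _ _))

-- Reduction in the number of ones

Descending : List ℕ → Set
Descending = AllPairs _>_

descending-unique : Descending xs → Unique xs
descending-unique = AllPairs.map >⇒≢

-- Giving the largest element x the coefficient 1 leaves room for h values below, and by reflection for h above.
many-sum-step : Descending (x ∷ xs) → h + j ≡ length xs → Many n (λ s → Sum j s xs) →
  Many (h + (n + h)) (λ s → Sum (suc j) s (x ∷ xs))
many-sum-step {x} {xs} {h} {j} {n} (x> ∷ desc) e l
  with m , p , least , low ← sum-least {j = j} (descending-unique desc) h e =
  many-++ proj₂ proj₂ low-disjoint lows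
    (many-++ {P = Mid} {Q = High} (λ (v≥ , _ , q) → v≥ , q) (λ (v> , q) → <⇒≤ (high⇒> v>) , q)
      (λ (_ , v≤ , _) (v> , _) → <⇒≱ v> v≤) mids highs)
  where
  σ² = sum xs + sum xs
  Low Mid High : ℕ → Set
  -- The sums of `xs` run from `m` to `σ²` - m by reflection, so those with coefficient 1 at `x` lie
  -- between x + m and x + `σ²` - m. The upper threshold is stated with `v + m` to avoid
  -- subtraction.
  Low v = v < x + m × Sum (suc j) v (x ∷ xs)
  Mid v = x + m ≤ v × v + m ≤ x + σ² × Sum (suc j) v (x ∷ xs)
  High v = x + σ² < v + m × Sum (suc j) v (x ∷ xs)
  low-disjoint : ∀ {v} → Low v → ¬ (x + m ≤ v × Sum (suc j) v (x ∷ xs))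
  low-disjoint (v< , _) (v≥ , _) = <⇒≱ v< v≥
  m+m≤σ² : m + m ≤ σ²
  m+m≤σ² with m′ , p′ , eq ← sum-reflect p = ≤-trans (+-monoʳ-≤ m (least p′)) (≤-reflexive eq)
  high⇒> : ∀ {v} → x + σ² < v + m → x + m < v
  high⇒> {v} v> = +-cancelʳ-< m (x + m) v
    (≤-<-trans (≤-trans (≤-reflexive (+-assoc x m m)) (+-monoʳ-≤ x m+m≤σ²)) v>)
  t<x : ∀ {t} → t ∈ xs → t < x
  t<x = All.lookup x>
  -- Coefficient 0 at `x` and a zero coefficient of the least sum raised to 1 give m + t, which is
  -- below x + m because t < x.
  lows : Many h Low
  lows = many-map (m +_) (λ _ _ → +-cancelˡ-≡ m _ _)
    (λ {t} (t∈ , q) → <-≤-trans (+-monoʳ-< m (t<x t∈)) (≤-reflexive (+-comm m x)) , skip q) low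
  mids : Many n Mid
  mids = many-map (x +_) (λ _ _ → +-cancelˡ-≡ x _ _) mid l
    where
    mid : ∀ {s} → Sum j s xs → Mid (x + s)
    mid {s} q with s′ , q′ , eq ← sum-reflect q =
      +-monoʳ-≤ x (least q) ,
      ≤-trans (≤-reflexive (+-assoc x s m)) (+-monoʳ-≤ x (≤-trans (+-monoʳ-≤ s (least q′)) (≤-reflexive eq))) ,
      one q
  S = x + sum xs + (x + sum xs)
  mirror : ∀ {t} → t ∈ xs × Sum (suc j) (m + t) xs → ∃ λ v → Sum (suc j) v (x ∷ xs) × m + t + v ≡ S
  mirror (_ , q) = sum-reflect (skip q)
  -- The reflections of the low values in the whole list.
  highs : Many h High
  highs = many-map (λ t → S ∸ (m + t))
    (λ q q′ eq → +-cancelˡ-≡ m _ _ (∸-cancelˡ-≡ (below q) (below q′) eq)) high low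
    where
    below : ∀ {t} → t ∈ xs × Sum (suc j) (m + t) xs → m + t ≤ S
    below {t} q with v , _ , eq ← mirror q = subst (m + t ≤_) eq (m≤m+n _ v)
    high : ∀ {t} → t ∈ xs × Sum (suc j) (m + t) xs → High (S ∸ (m + t))
    high {t} q@(t∈ , _) with v , q′ , eq ← mirror q =
      subst High (≡-trans (sym (m+n∸m≡n (m + t) v)) (cong (_∸ (m + t)) eq)) (v> , q′)
      where
      open ≤-Reasoning
      v> : x + σ² < v + m
      v> = +-cancelˡ-< t (x + σ²) (v + m) (begin-strict
        t + (x + σ²)          <⟨ +-monoˡ-< (x + σ²) (t<x t∈) ⟩
        x + (x + σ²)          ≡⟨ +-assoc x x σ² ⟨
        x + x + σ²            ≡⟨ ℕ-Semigroup.interchange x x (sum xs) (sum xs) ⟩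
        S                     ≡⟨ eq ⟨
        m + t + v             ≡⟨ cong (_+ v) (+-comm m t) ⟩
        t + m + v             ≡⟨ +-assoc t m v ⟩
        t + (m + v)           ≡⟨ cong (t +_) (+-comm m v) ⟩
        t + (v + m)           ∎)

-- One coefficient 1: elements of both parities

par : ℕ → Bool
par zero = false
par (suc n) = not (par n)

par-+ : ∀ m n → par (m + n) ≡ par m xor par n
par-+ zero n = refl
par-+ (suc m) n rewrite par-+ m n = not-xor (par m)
  where
  not-xor : ∀ b {c} → not (b xor c) ≡ not b xor c
  not-xor true  = not-involutive _
  not-xor false = refl

par-double : ∀ n → par (n + n) ≡ false
par-double n = ≡-trans (par-+ n n) (xor-same (par n))

sum₀-even : Sum 0 s xs → par s ≡ false
sum₀-even nil = refl
sum₀-even (add neg p refl refl) = sum₀-even p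
sum₀-even {xs = x ∷ _} (add {s = s} pos p refl refl) =
  ≡-trans (par-+ (x + x) s) (cong₂ _xor_ (par-double x) (sum₀-even p))

double-injective : x + x ≡ y + y → x ≡ y
double-injective {x} {y} eq = ≡-trans (n≡⌊n+n/2⌋ x) (≡-trans (cong ⌊_/2⌋ eq) (sym (n≡⌊n+n/2⌋ y)))

tri : ℕ → ℕ
tri zero = 0
tri (suc n) = suc n + tri n

-- Without ones, a sum is twice a subset sum. Below 2x lie 0 and 2t for each smaller element t; from
-- 2x on lie the sums of the tail shifted by 2x. Each element thus adds as many values as its rank,
-- which makes a triangular number.
many-subset-sums : Descending xs → All (0 <_) xs → Many (suc (tri (length xs))) (λ s → Sum 0 s xs)
many-subset-sums [] [] = many-insert nil many-[]
many-subset-sums {x ∷ xs} (x> ∷ desc) (x>0 ∷ xs>0) =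
  many-cast (+-suc (suc (length xs)) (tri (length xs))) (
  many-++ {P = λ s → s < x + x × Sum 0 s (x ∷ xs)} {Q = λ s → x + x ≤ s × Sum 0 s (x ∷ xs)}
    proj₂ proj₂ (λ (s< , _) (s≥ , _) → <⇒≱ s< s≥)
    low
    (many-map (x + x +_) (λ _ _ → +-cancelˡ-≡ (x + x) _ _) (λ p → m≤m+n (x + x) _ , two p) (many-subset-sums desc xs>0)))
  where
  low : Many (suc (length xs)) (λ s → s < x + x × Sum 0 s (x ∷ xs))
  low = many-insert (<-≤-trans x>0 (m≤m+n x x) , sum-zero)
    (many-map (λ t → t + t) (λ _ _ → double-injective)
      (λ t∈ → <⇒≢ (<-≤-trans (All.lookup xs>0 t∈) (m≤m+n _ _)) ,
        +-mono-< (All.lookup x> t∈) (All.lookup x> t∈) , skip (sum-two t∈))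
      (many-list (descending-unique desc) id))

hasParity? : ∀ b x → Dec (par x ≡ b)
hasParity? b x = par x Bool.≟ b

ofParity : Bool → List ℕ → List ℕ
ofParity b = filter (hasParity? b)

-- y is the largest element of parity b, and ys is xs without y.
parity-class : ∀ b → Descending xs → All (0 <_) xs → ofParity b xs ≡ [] ⊎
  ∃ λ n → length (ofParity b xs) ≡ suc n × ∃ λ y → ∃ λ ys → length xs ≡ suc (length ys) × Descending ys × All (0 <_) ys ×
    (∀ {z} → z ∈ ys → z ∈ xs) × par y ≡ b × (∀ {s} → Sum 0 s ys → Sum 1 (y + s) xs) ×
    Many n (λ z → z < y × z ∈ xs × par z ≡ b)
parity-class b [] [] = inj₁ refl
parity-class {x ∷ xs} b (x> ∷ desc) (x>0 ∷ xs>0) with hasParity? b x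
... | yes par-x = inj₂ (_ , refl , x , xs , refl , desc , xs>0 , there , par-x , one ,
  many-list (Uniqueₚ.filter⁺ (hasParity? b) (descending-unique desc))
    λ z∈ → let z∈xs , par-z = ∈-filter⁻ (hasParity? b) {xs = xs} z∈ in All.lookup x> z∈xs , there z∈xs , par-z)
... | no _ with parity-class b desc xs>0
...   | inj₁ none = inj₁ none
...   | inj₂ (n , e , y , ys , e′ , desc′ , ys>0 , ⊆ , par-y , lift , l) =
  inj₂ (n , e , y , x ∷ ys , cong suc e′ , All.tabulate (All.lookup x> ∘ ⊆) ∷ desc′ , x>0 ∷ ys>0 ,
    (λ { (here eq) → here eq ; (there z∈) → there (⊆ z∈) }) , par-y , lift′ ,
    many-weaken (λ (z< , z∈ , par-z) → z< , there z∈ , par-z) l)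
  where
  lift′ : ∀ {s} → Sum 0 s (x ∷ ys) → Sum 1 (y + s) (x ∷ xs)
  lift′ (add neg p refl refl) = skip (lift p)
  lift′ (add {s = s} pos p refl refl) = add pos (lift p) refl (ℕ-Semigroup.x∙yz≈y∙xz (x + x) y s)

-- The elements below `y` are values by themselves. The sums of the others without ones are even, so
-- adding `y` to them keeps the parity `b` and never falls below `y`.
many-of-parity : ∀ b → Descending xs → All (0 <_) xs → length xs ≡ suc k →
  ofParity b xs ≡ [] ⊎ Many (length (ofParity b xs) + tri k) (λ s → par s ≡ b × Sum 1 s xs)
many-of-parity {xs} {k} b desc xs>0 e with parity-class b desc xs>0
... | inj₁ none = inj₁ none
... | inj₂ (n , e′ , y , ys , e″ , desc′ , ys>0 , _ , par-y , lift , l) =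
  inj₂ (many-cast count
    (many-++ {P = λ s → s < y × s ∈ xs × par s ≡ b} {Q = λ s → y ≤ s × par s ≡ b × Sum 1 s xs}
      (λ (_ , s∈ , par-s) → par-s , sum-one s∈) proj₂ (λ (s< , _) (s≥ , _) → <⇒≱ s< s≥)
      l (many-map (y +_) (λ _ _ → +-cancelˡ-≡ y _ _)
        (λ {s} p → m≤m+n y _ , ≡-trans (par-+ y s) (≡-trans (cong₂ _xor_ par-y (sum₀-even p)) (xor-identityʳ b)) , lift p)
        (many-subset-sums desc′ ys>0))))
  where
  count : n + suc (tri (length ys)) ≡ length (ofParity b xs) + tri k
  count rewrite e′ | suc-injective (≡-trans (sym e″) e) = +-suc n (tri k)

square-suc : ∀ n → suc n + suc n + (n * n + n) ≡ suc n * suc n + suc n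
square-suc = solve-∀

square-suc′ : ∀ n → suc n + (n * n + n) ≡ suc n * suc n
square-suc′ = solve-∀

tri-double : ∀ n → tri n + tri n ≡ n * n + n
tri-double zero = refl
tri-double (suc n) = begin
  suc n + tri n + (suc n + tri n)       ≡⟨ ℕ-Semigroup.interchange (suc n) (tri n) (suc n) (tri n) ⟩
  suc n + suc n + (tri n + tri n)       ≡⟨ cong (suc n + suc n +_) (tri-double n) ⟩
  suc n + suc n + (n * n + n)           ≡⟨ square-suc n ⟩
  suc n * suc n + suc n                 ∎
  where open ≡-Reasoning

length-ofParity : ∀ xs → length (ofParity true xs) + length (ofParity false xs) ≡ length xs
length-ofParity [] = refl
length-ofParity (x ∷ xs) with par x
... | true  = cong suc (length-ofParity xs)
... | false = ≡-trans (+-suc (length (ofParity true xs)) _) (cong suc (length-ofParity xs))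

-- The two class sizes add up to `suc k`, and the two copies of `tri k` to k² + k.
many-sum₁-mixed : Descending xs → All (0 <_) xs → length xs ≡ suc k → ofParity true xs ≢ [] → ofParity false xs ≢ [] →
  Many (suc k * suc k) (λ s → Sum 1 s xs)
many-sum₁-mixed {xs} {k} desc xs>0 e odd even with many-of-parity true desc xs>0 e | many-of-parity false desc xs>0 e
... | inj₁ none | _ = contradiction none odd
... | inj₂ _ | inj₁ none = contradiction none even
... | inj₂ l | inj₂ l′ = many-cast count
  (many-++ proj₂ proj₂ (λ (odd-s , _) (even-s , _) → true≢false (≡-trans (sym odd-s) even-s)) l l′)
  where
  open ≡-Reasoning
  true≢false : true ≢ false
  true≢false ()
  o = length (ofParity true xs)
  v = length (ofParity false xs)
  count : o + tri k + (v + tri k) ≡ suc k * suc k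
  count = begin
    o + tri k + (v + tri k)   ≡⟨ ℕ-Semigroup.interchange o (tri k) v (tri k) ⟩
    o + v + (tri k + tri k)   ≡⟨ cong₂ _+_ (≡-trans (length-ofParity xs) e) (tri-double k) ⟩
    suc k + (k * k + k)       ≡⟨ square-suc′ k ⟩
    suc k * suc k             ∎

-- All elements even: halving

half-double : ∀ x → par x ≡ false → ⌊ x /2⌋ + ⌊ x /2⌋ ≡ x
half-double zero _ = refl
half-double (suc (suc x)) e = cong suc (≡-trans (+-suc ⌊ x /2⌋ ⌊ x /2⌋)
  (cong suc (half-double x (≡-trans (sym (not-involutive (par x))) e))))

halve : List ℕ → List ℕ
halve = map ⌊_/2⌋

Even Odd : ℕ → Set
Even x = par x ≡ false
Odd x = par x ≡ true

halve-sum : All Even xs → Sum j s (halve xs) → Sum j (s + s) xs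
halve-sum [] nil = nil
halve-sum {x ∷ xs} (even ∷ evens) (add {s = s} c p e refl) = add c (halve-sum evens p) e (mult-half c)
  where
  x/2 = ⌊ x /2⌋
  mult-half : ∀ c → mult c x + (s + s) ≡ mult c x/2 + s + (mult c x/2 + s)
  mult-half neg = refl
  mult-half zer = ≡-trans (cong (_+ (s + s)) (sym (half-double x even))) (ℕ-Semigroup.interchange x/2 x/2 s s)
  mult-half pos = ≡-trans (cong (λ z → z + z + (s + s)) (sym (half-double x even)))
    (ℕ-Semigroup.interchange (x/2 + x/2) (x/2 + x/2) s s)

double-cancel-< : ∀ {x y} → x + x < y + y → x < y
double-cancel-< {x} {y} lt with x ℕ.<? y
... | yes x<y = x<y
... | no x≮y = contradiction (+-mono-≤ (≮⇒≥ x≮y) (≮⇒≥ x≮y)) (<⇒≱ lt)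

half-< : Even x → Even y → x < y → ⌊ x /2⌋ < ⌊ y /2⌋
half-< {x} {y} ex ey lt = double-cancel-< (subst₂ _<_ (sym (half-double x ex)) (sym (half-double y ey)) lt)

halve-descending : All Even xs → Descending xs → Descending (halve xs)
halve-descending [] [] = []
halve-descending (even ∷ evens) (x> ∷ desc) =
  Allₚ.map⁺ (All.zipWith (λ (ey , lt) → half-< ey even lt) (evens , x>)) ∷ halve-descending evens desc

halve-positive : All Even xs → All (0 <_) xs → All (0 <_) (halve xs)
halve-positive evens xs>0 = Allₚ.map⁺ (All.zipWith (λ (ex , lt) → half-< refl ex lt) (evens , xs>0))

-- All elements odd: adding a largest element

-- The second binary digit, which separates 1 and 3 modulo 4.
bit : ℕ → Bool
bit zero = false
bit (suc zero) = false
bit (suc (suc n)) = not (bit n)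

-- Adding 2 flips the bit, so adding `x + x` flips it `x` times.
bit-double : ∀ x s → bit (x + x + s) ≡ par x xor bit s
bit-double zero s = refl
bit-double (suc x) s rewrite +-suc x x | bit-double x s with par x
... | true  = not-involutive (bit s)
... | false = refl

bit-flip : Odd x → bit (x + x + s) ≡ not (bit s)
bit-flip {x} {s} odd = ≡-trans (bit-double x s) (cong (_xor bit s) odd)

double-< : ∀ w → x < y → x + x + w < y + y + w
double-< w lt = +-monoˡ-< w (+-mono-< lt lt)

double-swap-< : x < y → x + x + y < y + y + x
double-swap-< {x} {y} lt = begin-strict
  x + x + y   ≡⟨ +-assoc x x y ⟩
  x + (x + y) <⟨ +-monoˡ-< (x + y) lt ⟩
  y + (x + y) ≡⟨ cong (y +_) (+-comm x y) ⟩
  y + (y + x) ≡⟨ +-assoc y y x ⟨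
  y + y + x   ∎
  where open ≤-Reasoning

<-two-+ : 0 < y → x < y + y + x
<-two-+ {y} {x} y>0 = +-monoˡ-< x (<-≤-trans y>0 (m≤m+n y y))

sum₀-cases : Sum 0 s xs → s ≡ 0 ⊎ ∃ λ v → v ∈ xs × v + v ≤ s
sum₀-cases nil = inj₁ refl
sum₀-cases (add neg p refl refl) with sum₀-cases p
... | inj₁ e = inj₁ e
... | inj₂ (v , v∈ , v≤) = inj₂ (v , there v∈ , v≤)
sum₀-cases {xs = x ∷ _} (add pos p refl refl) = inj₂ (x , here refl , m≤m+n (x + x) _)

-- Let u carry the coefficient 1. If no element carries 2, the value is u; if v does, the value is
-- at least 2v + u.
sum₁-cases : Unique xs → Sum 1 s xs → s ∈ xs ⊎
  ∃ λ u → ∃ λ v → u ∈ xs × v ∈ xs × u ≢ v × v + v + u ≤ s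
sum₁-cases (x∉ ∷ uniq) (add neg p refl refl) with sum₁-cases uniq p
... | inj₁ s∈ = inj₁ (there s∈)
... | inj₂ (u , v , u∈ , v∈ , u≢v , le) = inj₂ (u , v , there u∈ , there v∈ , u≢v , le)
sum₁-cases {x ∷ _} (x∉ ∷ uniq) (add {s = s} zer p refl refl) with sum₀-cases p
... | inj₁ refl = inj₁ (here (+-identityʳ x))
... | inj₂ (v , v∈ , v≤) = inj₂ (x , v , here refl , there v∈ , All.lookup x∉ v∈ ,
  ≤-trans (+-monoˡ-≤ x v≤) (≤-reflexive (+-comm s x)))
sum₁-cases {x ∷ _} (x∉ ∷ uniq) (add pos p refl refl) with sum₁-cases uniq p
... | inj₁ s∈ = inj₂ (_ , x , there s∈ , here refl , (All.lookup x∉ s∈ ∘ sym) , ≤-refl)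
... | inj₂ (u , v , u∈ , v∈ , u≢v , le) = inj₂ (u , x , there u∈ , here refl , (All.lookup x∉ u∈ ∘ sym) ,
  +-monoʳ-≤ (x + x) (≤-trans (m≤n+m u (v + v)) le))

descending-++⁻ : ∀ xs → Descending (xs ++ ys) → Descending xs × Descending ys × (∀ {x y} → x ∈ xs → y ∈ ys → y < x)
descending-++⁻ [] desc = [] , desc , λ ()
descending-++⁻ (x ∷ xs) (x> ∷ desc) with d , d′ , cross ← descending-++⁻ xs desc =
  Allₚ.++⁻ˡ xs x> ∷ d , d′ , λ { (here refl) y∈ → All.lookup (Allₚ.++⁻ʳ xs x>) y∈ ; (there x∈) y∈ → cross x∈ y∈ }

least-of : (∀ z → Dec (Q z)) → ∀ xs →
  (∀ {z} → z ∈ xs → ¬ Q z) ⊎ ∃ λ y → y ∈ xs × Q y × (∀ {z} → z ∈ xs → Q z → y ≤ z)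
least-of Q? [] = inj₁ λ ()
least-of Q? (x ∷ xs) with Q? x | least-of Q? xs
... | yes qx | inj₁ none =
  inj₂ (x , here refl , qx , λ { (here refl) _ → ≤-refl ; (there z∈) qz → contradiction qz (none z∈) })
... | no ¬qx | inj₁ none = inj₁ λ { (here refl) → ¬qx ; (there z∈) → none z∈ }
... | no ¬qx | inj₂ (y , y∈ , qy , least) =
  inj₂ (y , there y∈ , qy , λ { (here refl) qz → contradiction qz ¬qx ; (there z∈) qz → least z∈ qz })
... | yes qx | inj₂ (y , y∈ , qy , least) with ≤-total x y
...   | inj₁ x≤y = inj₂ (x , here refl , qx , λ { (here refl) _ → ≤-refl ; (there z∈) qz → ≤-trans x≤y (least z∈ qz) })
...   | inj₂ y≤x = inj₂ (y , there y∈ , qy , λ { (here refl) _ → y≤x ; (there z∈) qz → least z∈ qz })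

many-remove : Unique xs → y ∈ xs → length xs ≡ suc n → Many n (λ z → z ∈ xs × z ≢ y)
many-remove (x∉ ∷ u) (here refl) refl =
  many-weaken (λ z∈ → there z∈ , (All.lookup x∉ z∈ ∘ sym)) (many-list u id)
many-remove {xs = x ∷ x′ ∷ xs} (x∉ ∷ u) (there y∈) refl =
  many-insert (here refl , All.lookup x∉ y∈)
    (many-weaken (λ (z∈ , z≢) → All.lookup x∉ z∈ , there z∈ , z≢) (many-remove u y∈ refl))

-- `x` is the largest element, `a₁` < `a₂` < `a₃` are the three least, and `ms` lies between. With k
-- = 4 + `length ms` elements in all, 2k - 1 values have to be added to those of `as`.
module OddStep {x a₁ a₂ a₃ ms} (desc : Descending (x ∷ ms ++ a₃ ∷ a₂ ∷ a₁ ∷ []))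
  (positive : All (0 <_) (x ∷ ms ++ a₃ ∷ a₂ ∷ a₁ ∷ [])) (odds : All Odd (x ∷ ms ++ a₃ ∷ a₂ ∷ a₁ ∷ [])) where

  low as all : List ℕ
  low = a₃ ∷ a₂ ∷ a₁ ∷ []
  as = ms ++ low
  all = x ∷ as

  low-desc : Descending low
  low-desc = descending-++⁻ ms (AllPairs.tail desc) .proj₂ .proj₁

  ms-unique : Unique (a₃ ∷ ms)
  ms-unique with d , _ , cross ← descending-++⁻ ms (AllPairs.tail desc) =
    All.tabulate (λ z∈ → <⇒≢ (cross z∈ (here refl))) ∷ descending-unique d

  ms> : z ∈ ms → a₃ < z
  ms> z∈ = descending-++⁻ ms (AllPairs.tail desc) .proj₂ .proj₂ z∈ (here refl)

  a₁<a₂ : a₁ < a₂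
  a₁<a₂ with _ ∷ (lt ∷ _) ∷ _ ← low-desc = lt

  a₂<a₃ : a₂ < a₃
  a₂<a₃ with (lt ∷ _) ∷ _ ← low-desc = lt

  a₁<a₃ : a₁ < a₃
  a₁<a₃ = <-trans a₁<a₂ a₂<a₃

  a₁∈ : a₁ ∈ as
  a₁∈ = ∈-++⁺ʳ ms (there (there (here refl)))

  a₂∈ : a₂ ∈ as
  a₂∈ = ∈-++⁺ʳ ms (there (here refl))

  a₃∈ : a₃ ∈ as
  a₃∈ = ∈-++⁺ʳ ms (here refl)

  as-unique : Unique as
  as-unique = descending-unique (AllPairs.tail desc)

  x> : z ∈ as → z < x
  x> = All.lookup (AllPairs.head desc)

  ⊆as : z ∈ a₃ ∷ ms → z ∈ as
  ⊆as (here refl) = a₃∈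
  ⊆as (there z∈) = ∈-++⁺ˡ z∈

  a₃≤ : z ∈ a₃ ∷ ms → a₃ ≤ z
  a₃≤ (here refl) = ≤-refl
  a₃≤ (there z∈) = <⇒≤ (ms> z∈)

  a₁>0 : 0 < a₁
  a₁>0 = All.lookup positive (there a₁∈)

  ≡a₁⊎a₂≤ : z ∈ as → z ≡ a₁ ⊎ a₂ ≤ z
  ≡a₁⊎a₂≤ z∈ with ∈-++⁻ ms z∈
  ... | inj₁ z∈ms = inj₂ (<⇒≤ (<-trans a₂<a₃ (ms> z∈ms)))
  ... | inj₂ (here refl) = inj₂ (<⇒≤ a₂<a₃)
  ... | inj₂ (there (here refl)) = inj₂ ≤-refl
  ... | inj₂ (there (there (here refl))) = inj₁ refl

  a₁≤ : z ∈ as → a₁ ≤ z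
  a₁≤ z∈ with ≡a₁⊎a₂≤ z∈
  ... | inj₁ refl = ≤-refl
  ... | inj₂ a₂≤z = ≤-trans (<⇒≤ a₁<a₂) a₂≤z

  two-terms≥ : {u v : ℕ} → u ∈ as → v ∈ as → u ≢ v → a₁ + a₁ + a₂ ≤ v + v + u
  two-terms≥ {u} {v} u∈ v∈ u≢v with ≡a₁⊎a₂≤ u∈ | ≡a₁⊎a₂≤ v∈
  ... | inj₁ refl | inj₁ refl = contradiction refl u≢v
  ... | inj₂ a₂≤u | _ = +-mono-≤ (+-mono-≤ (a₁≤ v∈) (a₁≤ v∈)) a₂≤u
  ... | inj₁ refl | inj₂ a₂≤v = ≤-trans (<⇒≤ (double-swap-< a₁<a₂)) (+-monoˡ-≤ a₁ (+-mono-≤ a₂≤v a₂≤v))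

  -- Among the 2v + u the least is `a₁ + a₁ + a₂`, so below it every value is an element. This
  -- locates the least value of each class.
  sum₁-as : Sum 1 s as → s ∈ as ⊎ a₁ + a₁ + a₂ ≤ s
  sum₁-as p with sum₁-cases as-unique p
  ... | inj₁ s∈ = inj₁ s∈
  ... | inj₂ (u , v , u∈ , v∈ , u≢v , le) = inj₂ (≤-trans (two-terms≥ u∈ v∈ u≢v) le)

  a₁-least : Sum 1 s as → a₁ ≤ s
  a₁-least p with sum₁-as p
  ... | inj₁ s∈ = a₁≤ s∈
  ... | inj₂ le = ≤-trans (≤-trans (m≤m+n a₁ a₁) (m≤m+n (a₁ + a₁) a₂)) le

  -- For odd `s` this is congruence to `a₁` modulo 4, and `Other` is congruence to `a₁` + 2;
  -- measuring against `a₁` avoids a split on its own residue. A record lets `s` be inferred, which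
  -- an equation of bits would not.
  record Same (s : ℕ) : Set where
    constructor same
    field bit≡ : bit s ≡ bit a₁

  record Other (s : ℕ) : Set where
    constructor other
    field bit≡ : bit s ≡ not (bit a₁)

  same⊎other : ∀ s → Same s ⊎ Other s
  same⊎other s with bit s Bool.≟ bit a₁
  ... | yes eq = inj₁ (same eq)
  ... | no neq = inj₂ (other (¬-not neq))

  same⇒¬other : Same s → ¬ Other s
  same⇒¬other (same eq) (other eq′) = not-¬ refl (≡-trans (sym eq) eq′)

  other? : ∀ s → Dec (Other s)
  other? s with same⊎other s
  ... | inj₁ p = no (same⇒¬other p)
  ... | inj₂ p = yes p

  same-a₁ : Same a₁
  same-a₁ = same refl

  flip-same : z ∈ all → Same s → Other (z + z + s)
  flip-same {z} {s} z∈ (same eq) = other (≡-trans (bit-flip {z} {s} (All.lookup odds z∈)) (cong not eq))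

  flip-other : z ∈ all → Other s → Same (z + z + s)
  flip-other {z} {s} z∈ (other eq) =
    same (≡-trans (bit-flip {z} {s} (All.lookup odds z∈)) (≡-trans (cong not eq) (not-involutive (bit a₁))))

  LowOther : ℕ → Set
  LowOther s = s < x + x + a₁ × Other s × Sum 1 s all

  LowSame : ℕ → ℕ → Set
  LowSame m s = s < x + x + m × Same s × Sum 1 s all

  -- Shifting by x + x exchanges the two classes, so the shifted sums of as are at least x + x + a₁ in the other class and
  -- at least x + x + m in the class of a₁.
  assemble : ∀ {p q n} m → (∀ {s} → Sum 1 s as → Other s → m ≤ s) →
    Many p LowOther → Many q (LowSame m) → Many n (λ s → Sum 1 s as) → Many (p + (q + n)) (λ s → Sum 1 s all)
  assemble m m≤ others sames rest =
    many-++ {P = LowOther} {Q = λ s → (Other s → x + x + a₁ ≤ s) × Sum 1 s all}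
      (λ (_ , _ , p) → p) proj₂ (λ (s< , q , _) (s≥ , _) → <⇒≱ s< (s≥ q)) others
      (many-++ {P = LowSame m} {Q = λ s → x + x + a₁ ≤ s × (Same s → x + x + m ≤ s) × Sum 1 s all}
        (λ (_ , q , p) → (λ q′ → contradiction q′ (same⇒¬other q)) , p) (λ (s≥ , _ , p) → (λ _ → s≥) , p)
        (λ (s< , q , _) (_ , s≥ , _) → <⇒≱ s< (s≥ q)) sames
        (many-map (x + x +_) (λ _ _ → +-cancelˡ-≡ (x + x) _ _)
          (λ p → +-monoʳ-≤ (x + x) (a₁-least p) , (λ q → +-monoʳ-≤ (x + x) (m≤ p (unflip q))) , two p) rest))
    where
    unflip : ∀ {s} → Same (x + x + s) → Other s
    unflip {s} p with same⊎other s
    ... | inj₁ q = contradiction (flip-same (here refl) q) (same⇒¬other p)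
    ... | inj₂ q = q

  length-as : length as ≡ 3 + length ms
  length-as = ≡-trans (length-++ ms) (+-comm (length ms) 3)

  -- The main supply of new values: one for each of the k - 2 elements of `as` other than `y`, all
  -- in the class opposite to that of `y`, and all below `x + x + y` since d < x.
  Doubled : ℕ → ℕ → Set
  Doubled y s = ∃ λ d → d ∈ as × y ≢ d × s ≡ d + d + y

  doubled-< : Doubled y s → s < x + x + y
  doubled-< {y} (d , d∈ , _ , refl) = double-< y (x> d∈)

  doubled-sum : y ∈ as → Doubled y s → Sum 1 s all
  doubled-sum y∈ (d , d∈ , y≢d , refl) = sum-two-one (there d∈) (there y∈) y≢d

  doubled-> : Doubled y s → y < s
  doubled-> (d , d∈ , _ , refl) = <-two-+ (All.lookup positive (there d∈))

  doubled-other : Doubled a₁ s → Other s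
  doubled-other (d , d∈ , _ , refl) = flip-same (there d∈) same-a₁

  doubled-same : Other y → Doubled y s → Same s
  doubled-same p (d , d∈ , _ , refl) = flip-other (there d∈) p

  many-doubled : ∀ {y} → y ∈ as → Many (2 + length ms) (Doubled y)
  many-doubled {y} y∈ = many-map (λ d → d + d + y) (λ _ _ eq → double-injective (+-cancelʳ-≡ y _ _ eq))
    (λ (d∈ , d≢y) → _ , d∈ , (d≢y ∘ sym) , refl) (many-remove as-unique y∈ length-as)

  -- The values doubled over `a₁` start at `a₂ + a₂ + a₁`. One more lies below them: `a₂` if it is
  -- in the other class, and otherwise `a₁ + a₁ + a₂`. The origin of each value is recorded because
  -- the exceptional case needs a further value distinct from all of them.
  others : Many (3 + length ms) (λ s → LowOther s × (s ≡ a₂ ⊎ s ≡ a₁ + a₁ + a₂ ⊎ Doubled a₁ s))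
  others = first (same⊎other a₂)
    where
    doubled-≥ : Doubled a₁ s → a₂ + a₂ + a₁ ≤ s
    doubled-≥ (d , d∈ , a₁≢d , refl) with ≡a₁⊎a₂≤ d∈
    ... | inj₁ refl = contradiction refl a₁≢d
    ... | inj₂ a₂≤d = +-monoˡ-≤ a₁ (+-mono-≤ a₂≤d a₂≤d)
    with-doubled : ∀ {e} → e < a₂ + a₂ + a₁ → Other e → Sum 1 e all → e ≡ a₂ ⊎ e ≡ a₁ + a₁ + a₂ ⊎ Doubled a₁ e →
      Many (3 + length ms) (λ s → LowOther s × (s ≡ a₂ ⊎ s ≡ a₁ + a₁ + a₂ ⊎ Doubled a₁ s))
    with-doubled e< q p origin = many-insert ((<-trans e< (double-< a₁ (x> a₂∈)) , q , p) , origin)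
      (many-weaken (λ r → <⇒≢ (<-≤-trans e< (doubled-≥ r)) ,
        (doubled-< r , doubled-other r , doubled-sum a₁∈ r) , inj₂ (inj₂ r)) (many-doubled a₁∈))
    first : Same a₂ ⊎ Other a₂ → Many (3 + length ms) (λ s → LowOther s × (s ≡ a₂ ⊎ s ≡ a₁ + a₁ + a₂ ⊎ Doubled a₁ s))
    first (inj₁ q) = with-doubled (double-swap-< a₁<a₂) (flip-same (there a₁∈) q)
      (sum-two-one (there a₁∈) (there a₂∈) (>⇒≢ a₁<a₂)) (inj₂ (inj₁ refl))
    first (inj₂ q) = with-doubled (<-≤-trans (<-two-+ a₁>0) (<⇒≤ (double-swap-< a₁<a₂)))
      q (sum-one (there a₂∈)) (inj₁ refl)

  -- The case where the least value of the other class is a₁ + a₁ + a₂.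
  sames-far : Same a₂ → Many (4 + length ms) (LowSame (a₁ + a₁ + a₂))
  sames-far same-a₂ = many-weaken proj₂ (many-cons a₁>0 (a₁< , same-a₁ , sum-one (there a₁∈))
    (many-cons a₁<a₂ (a₂< , same-a₂ , sum-one (there a₂∈)) (third (same⊎other a₃))))
    where
    μ = a₁ + a₁ + a₂
    a₂<μ : a₂ < μ
    a₂<μ = <-two-+ a₁>0
    μ<x+x+μ : μ < x + x + μ
    μ<x+x+μ = <-two-+ (≤-<-trans z≤n (x> a₁∈))
    a₂< : a₂ < x + x + μ
    a₂< = <-trans a₂<μ μ<x+x+μ
    a₁< : a₁ < x + x + μ
    a₁< = <-trans a₁<a₂ a₂<
    -- `μ` is in the other class, so adding d + d returns to the class of `a₁`. As `μ` already uses
    -- `a₁` and `a₂`, d ranges over the elements from `a₃` on.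
    rest : ∀ {e} → e < a₃ + a₃ + μ → Many (1 + length ms) (λ s → e < s × LowSame μ s)
    rest e< = many-map (λ d → d + d + μ) (λ _ _ eq → double-injective (+-cancelʳ-≡ μ _ _ eq))
      shifted (many-list ms-unique id)
      where
      shifted : ∀ {d} → d ∈ a₃ ∷ ms → _ < d + d + μ × LowSame μ (d + d + μ)
      shifted d∈ = <-≤-trans e< (+-monoˡ-≤ μ (+-mono-≤ (a₃≤ d∈) (a₃≤ d∈))) , double-< μ (x> (⊆as d∈)) ,
        flip-other (there (⊆as d∈)) (flip-same (there a₁∈) same-a₂) ,
        sum-two-two-one (there (⊆as d∈)) (there a₁∈) (there a₂∈)
          (<⇒≢ (<-≤-trans a₁<a₃ (a₃≤ d∈))) (<⇒≢ (<-≤-trans a₂<a₃ (a₃≤ d∈))) (>⇒≢ a₁<a₂)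
    -- After `a₁` and `a₂` comes whichever of `a₃` and `a₁ + a₁ + a₃` is in the class of `a₁`; both
    -- precede the values of `rest`.
    third : Same a₃ ⊎ Other a₃ → Many (2 + length ms) (λ s → a₂ < s × LowSame μ s)
    third (inj₁ same-a₃) = many-cons a₂<a₃ (<-trans a₃< (double-< μ (x> a₃∈)) , same-a₃ , sum-one (there a₃∈)) (rest a₃<)
      where
      a₃< : a₃ < a₃ + a₃ + μ
      a₃< = <-≤-trans (m<m+n a₃ (<-trans a₁>0 a₁<a₃)) (m≤m+n (a₃ + a₃) μ)
    third (inj₂ other-a₃) = many-cons (<-trans a₂<a₃ (<-two-+ a₁>0))
      (<-trans a₁₃< (double-< μ (x> a₃∈)) , flip-other (there a₁∈) other-a₃ ,
        sum-two-one (there a₁∈) (there a₃∈) (>⇒≢ a₁<a₃))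
      (rest a₁₃<)
      where
      a₁₃< : a₁ + a₁ + a₃ < a₃ + a₃ + μ
      a₁₃< = <-≤-trans (double-swap-< a₁<a₃) (+-monoʳ-≤ (a₃ + a₃) (≤-trans (m≤m+n a₁ a₁) (m≤m+n (a₁ + a₁) a₂)))

  -- The case where the least value of the other class is an element y beyond a₂.
  sames-near : Same a₂ → y ∈ as → Other y → Many (4 + length ms) (LowSame y)
  sames-near {y} same-a₂ y∈ other-y = many-weaken proj₂ (many-cons a₁>0 (a₁< , same-a₁ , sum-one (there a₁∈))
    (many-cons a₁<a₂ (a₂< , same-a₂ , sum-one (there a₂∈))
      (many-weaken (λ p → <-trans a₂<y (doubled-> p) , doubled-< p , doubled-same other-y p , doubled-sum y∈ p)
        (many-doubled y∈))))
    where
    a₂<y : a₂ < y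
    a₂<y with ≡a₁⊎a₂≤ y∈
    ... | inj₁ refl = contradiction other-y (same⇒¬other same-a₁)
    ... | inj₂ a₂≤y = ≤∧≢⇒< a₂≤y λ { refl → same⇒¬other same-a₂ other-y }
    a₂< : a₂ < x + x + y
    a₂< = <-≤-trans a₂<y (m≤n+m y (x + x))
    a₁< : a₁ < x + x + y
    a₁< = <-trans a₁<a₂ a₂<

  -- The case where the least value of the other class is a₂: the obvious values are one short, hence e.
  sames-next : ∀ {e} → Other a₂ → LowSame a₂ e → a₁ ≢ e → ¬ Doubled a₂ e → Many (4 + length ms) (LowSame a₂)
  sames-next {e} other-a₂ pe a₁≢e ¬doubled = many-insert pe
    (many-insert (a₁≢e ∘ sym , a₁< , same-a₁ , sum-one (there a₁∈))
    (many-weaken (λ p → <⇒≢ (<-trans a₁<a₂ (doubled-> p)) , (λ { refl → ¬doubled p }) ,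
      doubled-< p , doubled-same other-a₂ p , doubled-sum a₂∈ p) (many-doubled a₂∈)))
    where
    a₁< : a₁ < x + x + a₂
    a₁< = <-≤-trans a₁<a₂ (m≤n+m a₂ (x + x))

  doubled-a₂-cases : Doubled a₂ s → s ≡ a₁ + a₁ + a₂ ⊎ ∃ λ d → d ∈ a₃ ∷ ms × s ≡ d + d + a₂
  doubled-a₂-cases (d , d∈ , a₂≢d , eq) with ∈-++⁻ ms d∈
  ... | inj₁ d∈ms = inj₂ (d , there d∈ms , eq)
  ... | inj₂ (here refl) = inj₂ (d , here refl , eq)
  ... | inj₂ (there (here refl)) = contradiction refl a₂≢d
  ... | inj₂ (there (there (here refl))) = inj₁ eq

  -- The values doubled over `a₂` are `a₁ + a₁ + a₂` and then none below `a₃ + a₃ + a₂`, so under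
  -- that bound there is only one of them to avoid.
  sames-next-low : ∀ {e} → Other a₂ → e < a₃ + a₃ + a₂ → a₁ < e → e ≢ a₁ + a₁ + a₂ → Same e → Sum 1 e all →
    Many (4 + length ms) (LowSame a₂)
  sames-next-low other-a₂ e< a₁<e e≢ same-e p =
    sames-next other-a₂ (<-trans e< (double-< a₂ (x> a₃∈)) , same-e , p) (<⇒≢ a₁<e) ¬doubled
    where
    ¬doubled : ¬ Doubled a₂ _
    ¬doubled q with doubled-a₂-cases q
    ... | inj₁ eq = e≢ eq
    ... | inj₂ (d , d∈ , refl) = <⇒≱ e< (+-monoˡ-≤ a₂ (+-mono-≤ (a₃≤ d∈) (a₃≤ d∈)))

  -- The additional value is a₁ + a₁ + a₃ or a₃, unless a₃ = a₁ + a₁ + a₂. In that case, with a₄ the next element, it is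
  -- a₁ + 2 a₂ + 2 a₃ if a₄ is far from a₃, and otherwise a₄ or a₁ + a₁ + a₄.
  sames-next-extra : Other a₂ → Many (4 + length ms) (LowSame a₂)
  sames-next-extra other-a₂ with same⊎other a₃
  ... | inj₂ other-a₃ = sames-next-low other-a₂
    (<-trans (double-swap-< a₁<a₃) (+-monoʳ-< (a₃ + a₃) a₁<a₂)) (<-trans a₁<a₃ (<-two-+ a₁>0))
    (>⇒≢ (+-monoʳ-< (a₁ + a₁) a₂<a₃)) (flip-other (there a₁∈) other-a₃) (sum-two-one (there a₁∈) (there a₃∈) (>⇒≢ a₁<a₃))
  ... | inj₁ same-a₃ with a₃ ℕ.≟ a₁ + a₁ + a₂
  ...   | no a₃≢ = sames-next-low other-a₂ a₃< a₁<a₃ a₃≢ same-a₃ (sum-one (there a₃∈))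
    where
    a₃< : a₃ < a₃ + a₃ + a₂
    a₃< = <-≤-trans (m<m+n a₃ (<-trans a₁>0 a₁<a₃)) (m≤m+n (a₃ + a₃) a₂)
  -- The trivial predicate turns the search into a minimum: `a₄` is the element following `a₃`,
  -- possibly `x` itself.
  ...   | yes a₃≡ with least-of {Q = λ _ → ⊤} (λ _ → yes tt) (x ∷ ms)
  ...     | inj₁ none = contradiction tt (none (here refl))
  -- The test asks whether `a₃ + a₃ + (a₂ + a₂ + a₁)` is below `a₄ + a₄ + a₂`. If so, it falls
  -- strictly between two consecutive doubled values.
  ...     | inj₂ (a₄ , a₄∈ , _ , least) = go (a₁ + a₂ + (a₃ + a₃) ℕ.<? a₄ + a₄)
    where
    ⊆all : ∀ {d} → d ∈ x ∷ ms → d ∈ all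
    ⊆all (here refl) = here refl
    ⊆all (there d∈) = there (∈-++⁺ˡ d∈)
    above-a₃ : ∀ {d} → d ∈ x ∷ ms → a₃ < d
    above-a₃ (here refl) = x> a₃∈
    above-a₃ (there d∈) = ms> d∈
    a₄-bound : ∀ {d} → d ∈ x ∷ ms → a₄ + a₄ + a₂ ≤ d + d + a₂
    a₄-bound d∈ = +-monoˡ-≤ a₂ (+-mono-≤ (least d∈ tt) (least d∈ tt))
    a₁₂<a₄ : a₁ + a₁ + a₂ < a₄
    a₁₂<a₄ = ≤-<-trans (≤-reflexive (sym a₃≡)) (above-a₃ a₄∈)
    go : Dec (a₁ + a₂ + (a₃ + a₃) < a₄ + a₄) → Many (4 + length ms) (LowSame a₂)
    go (yes gap) = sames-next other-a₂
      (<-≤-trans e< (a₄-bound (here refl)) , flip-other (there a₃∈) (flip-same (there a₂∈) same-a₁) ,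
        sum-two-two-one (there a₃∈) (there a₂∈) (there a₁∈) (<⇒≢ a₂<a₃) (<⇒≢ a₁<a₃) (<⇒≢ a₁<a₂))
      (<⇒≢ (<-trans a₁<a₂ (<-trans (<-two-+ (<-trans a₁>0 a₁<a₃)) <e))) ¬doubled
      where
      open ≤-Reasoning
      rearrange : ∀ a b c → c + c + (b + b + a) ≡ a + b + (c + c) + b
      rearrange = solve-∀
      e< : a₃ + a₃ + (a₂ + a₂ + a₁) < a₄ + a₄ + a₂
      e< = begin-strict
        a₃ + a₃ + (a₂ + a₂ + a₁)     ≡⟨ rearrange a₁ a₂ a₃ ⟩
        a₁ + a₂ + (a₃ + a₃) + a₂     <⟨ +-monoˡ-< a₂ gap ⟩
        a₄ + a₄ + a₂                 ∎
      <e : a₃ + a₃ + a₂ < a₃ + a₃ + (a₂ + a₂ + a₁)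
      <e = +-monoʳ-< (a₃ + a₃) (<-≤-trans (m<m+n a₂ (<-trans a₁>0 a₁<a₂)) (m≤m+n (a₂ + a₂) a₁))
      ¬doubled : ¬ Doubled a₂ (a₃ + a₃ + (a₂ + a₂ + a₁))
      ¬doubled q with doubled-a₂-cases q
      ... | inj₁ eq = <⇒≢ (<-trans (double-< a₂ a₁<a₃) <e) (sym eq)
      ... | inj₂ (d , here refl , eq) = <⇒≢ <e (sym eq)
      ... | inj₂ (d , there d∈ , eq) = <⇒≢ (<-≤-trans e< (a₄-bound (there d∈))) eq
    -- Now 2a₄ < 2(a₃ + a₂). Since 2a₁ ≤ a₃, both `a₄` and `a₁ + a₁ + a₄` are below `a₃ + a₃ + a₂`,
    -- and exactly one of them is in the class of `a₁`.
    go (no ¬gap) = close (same⊎other a₄)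
      where
      open ≤-Reasoning
      rearrange : ∀ b c → b + b + (c + c) ≡ c + b + (c + b)
      rearrange = solve-∀
      a₄< : a₄ < a₃ + a₂
      a₄< = double-cancel-< (begin-strict
        a₄ + a₄                  ≤⟨ ≮⇒≥ ¬gap ⟩
        a₁ + a₂ + (a₃ + a₃)      <⟨ +-monoˡ-< (a₃ + a₃) (+-monoˡ-< a₂ a₁<a₂) ⟩
        a₂ + a₂ + (a₃ + a₃)      ≡⟨ rearrange a₂ a₃ ⟩
        a₃ + a₂ + (a₃ + a₂)      ∎)
      a₁₄< : a₁ + a₁ + a₄ < a₃ + a₃ + a₂
      a₁₄< = begin-strict
        a₁ + a₁ + a₄             <⟨ +-monoʳ-< (a₁ + a₁) a₄< ⟩
        a₁ + a₁ + (a₃ + a₂)      ≤⟨ +-monoˡ-≤ (a₃ + a₂) (≤-trans (m≤m+n (a₁ + a₁) a₂) (≤-reflexive (sym a₃≡))) ⟩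
        a₃ + (a₃ + a₂)           ≡⟨ +-assoc a₃ a₃ a₂ ⟨
        a₃ + a₃ + a₂             ∎
      a₁<a₄ : a₁ < a₄
      a₁<a₄ = <-trans a₁<a₃ (above-a₃ a₄∈)
      close : Same a₄ ⊎ Other a₄ → Many (4 + length ms) (LowSame a₂)
      close (inj₁ same-a₄) = sames-next-low other-a₂
        (≤-<-trans (m≤n+m a₄ (a₁ + a₁)) a₁₄<) a₁<a₄ (>⇒≢ a₁₂<a₄) same-a₄ (sum-one (⊆all a₄∈))
      close (inj₂ other-a₄) = sames-next-low other-a₂ a₁₄< (<-trans a₁<a₄ (<-two-+ a₁>0))
        (>⇒≢ (<-trans a₁₂<a₄ (<-two-+ a₁>0))) (flip-other (there a₁∈) other-a₄)
        (sum-two-one (there a₁∈) (⊆all a₄∈) (>⇒≢ a₁<a₄))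

  assemble-next : ∀ {p n} → Other a₂ → Many p LowOther → Many n (λ s → Sum 1 s as) →
    Many (p + (4 + length ms + n)) (λ s → Sum 1 s all)
  assemble-next other-a₂ lows = assemble a₂ a₂≤ lows (sames-next-extra other-a₂)
    where
    a₂≤ : Sum 1 s as → Other s → a₂ ≤ s
    a₂≤ p q with sum₁-as p
    ... | inj₂ le = ≤-trans (m≤n+m a₂ (a₁ + a₁)) le
    ... | inj₁ s∈ with ≡a₁⊎a₂≤ s∈
    ...   | inj₁ refl = contradiction q (same⇒¬other same-a₁)
    ...   | inj₂ le = le

  -- The cases follow the least value of `as` in the other class: `a₂`, else the least element of
  -- that class, else `a₁ + a₁ + a₂`. The two classes contribute k - 1 and k new values.
  many-step : ∀ {n} → Many n (λ s → Sum 1 s as) → Many (3 + length ms + (4 + length ms + n)) (λ s → Sum 1 s all)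
  many-step l with same⊎other a₂
  ... | inj₂ other-a₂ = assemble-next other-a₂ (many-weaken proj₁ others) l
  ... | inj₁ same-a₂ with least-of other? as
  ...   | inj₁ none = assemble (a₁ + a₁ + a₂) m≤ (many-weaken proj₁ others) (sames-far same-a₂) l
    where
    m≤ : Sum 1 s as → Other s → a₁ + a₁ + a₂ ≤ s
    m≤ p q with sum₁-as p
    ... | inj₁ s∈ = contradiction q (none s∈)
    ... | inj₂ le = le
  ...   | inj₂ (y , y∈ , other-y , least) with ≤-total y (a₁ + a₁ + a₂)
  ...     | inj₁ y≤ = assemble y m≤ (many-weaken proj₁ others) (sames-near same-a₂ y∈ other-y) l
    where
    m≤ : Sum 1 s as → Other s → y ≤ s
    m≤ p q with sum₁-as p
    ... | inj₁ s∈ = least s∈ q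
    ... | inj₂ le = ≤-trans y≤ le
  ...     | inj₂ ≤y = assemble (a₁ + a₁ + a₂) m≤ (many-weaken proj₁ others) (sames-far same-a₂) l
    where
    m≤ : Sum 1 s as → Other s → a₁ + a₁ + a₂ ≤ s
    m≤ p q with sum₁-as p
    ... | inj₁ s∈ = ≤-trans ≤y (least s∈ q)
    ... | inj₂ le = le

-- Three elements

module Three {a₁ a₂ a₃} (a₁>0 : 0 < a₁) (a₁<a₂ : a₁ < a₂) (a₂<a₃ : a₂ < a₃) where

  as : List ℕ
  as = a₃ ∷ a₂ ∷ a₁ ∷ []

  a₁<a₃ : a₁ < a₃
  a₁<a₃ = <-trans a₁<a₂ a₂<a₃

  a₁∈ : a₁ ∈ as
  a₁∈ = there (there (here refl))

  a₂∈ : a₂ ∈ as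
  a₂∈ = there (here refl)

  a₃∈ : a₃ ∈ as
  a₃∈ = here refl

  -- a₁ < a₂ < v₃ < … < v₈ are eight values that are distinct for all a₁ < a₂ < a₃.
  a₂<v₃ : a₂ < a₁ + a₁ + a₂
  a₂<v₃ = <-two-+ a₁>0

  v₃<v₄ : a₁ + a₁ + a₂ < a₁ + a₁ + a₃
  v₃<v₄ = +-monoʳ-< (a₁ + a₁) a₂<a₃

  v₄<v₅ : a₁ + a₁ + a₃ < a₂ + a₂ + a₃
  v₄<v₅ = double-< a₃ a₁<a₂

  v₅<v₆ : a₂ + a₂ + a₃ < a₃ + a₃ + a₂
  v₅<v₆ = double-swap-< a₂<a₃

  v₆<v₇ : a₃ + a₃ + a₂ < a₃ + a₃ + (a₁ + a₁ + a₂)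
  v₆<v₇ = +-monoʳ-< (a₃ + a₃) a₂<v₃

  v₇<v₈ : a₃ + a₃ + (a₁ + a₁ + a₂) < a₃ + a₃ + (a₂ + a₂ + a₁)
  v₇<v₈ = +-monoʳ-< (a₃ + a₃) (double-swap-< a₁<a₂)

  many-eight : Q a₁ → Q a₂ → Q (a₁ + a₁ + a₂) → Q (a₁ + a₁ + a₃) → Q (a₂ + a₂ + a₃) → Q (a₃ + a₃ + a₂) →
    Q (a₃ + a₃ + (a₁ + a₁ + a₂)) → Q (a₃ + a₃ + (a₂ + a₂ + a₁)) → Many 8 Q
  many-eight q₁ q₂ q₃ q₄ q₅ q₆ q₇ q₈ = many-weaken proj₂ (many-cons a₁>0 q₁ (many-cons a₁<a₂ q₂ (many-cons a₂<v₃ q₃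
    (many-cons v₃<v₄ q₄ (many-cons v₄<v₅ q₅ (many-cons v₅<v₆ q₆ (many-cons v₆<v₇ q₇ (many-cons v₇<v₈ q₈ many-[]))))))))

  p₁ : Sum 1 a₁ as
  p₁ = sum-one a₁∈

  p₂ : Sum 1 a₂ as
  p₂ = sum-one a₂∈

  p₃ : Sum 1 (a₁ + a₁ + a₂) as
  p₃ = sum-two-one a₁∈ a₂∈ (>⇒≢ a₁<a₂)

  p₄ : Sum 1 (a₁ + a₁ + a₃) as
  p₄ = sum-two-one a₁∈ a₃∈ (>⇒≢ a₁<a₃)

  p₅ : Sum 1 (a₂ + a₂ + a₃) as
  p₅ = sum-two-one a₂∈ a₃∈ (>⇒≢ a₂<a₃)

  p₆ : Sum 1 (a₃ + a₃ + a₂) as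
  p₆ = sum-two-one a₃∈ a₂∈ (<⇒≢ a₂<a₃)

  p₇ : Sum 1 (a₃ + a₃ + (a₁ + a₁ + a₂)) as
  p₇ = sum-two-two-one a₃∈ a₁∈ a₂∈ (<⇒≢ a₁<a₃) (<⇒≢ a₂<a₃) (>⇒≢ a₁<a₂)

  p₈ : Sum 1 (a₃ + a₃ + (a₂ + a₂ + a₁)) as
  p₈ = sum-two-two-one a₃∈ a₂∈ a₁∈ (<⇒≢ a₂<a₃) (<⇒≢ a₁<a₃) (<⇒≢ a₁<a₂)

  eight : Many 8 (λ s → Sum 1 s as)
  eight = many-eight p₁ p₂ p₃ p₄ p₅ p₆ p₇ p₈

  -- Among the eight values `a₃` can only equal `a₁ + a₁ + a₂`, and `a₂ + a₂ + a₁` can only equal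
  -- `a₁ + a₁ + a₃`. Both equalities together force the ratio 1 : 3 : 5.
  nine-or-exceptional : Many 9 (λ s → Sum 1 s as) ⊎ (a₃ ≡ a₁ + a₁ + a₂ × a₂ + a₂ + a₁ ≡ a₁ + a₁ + a₃)
  nine-or-exceptional with a₃ ℕ.≟ a₁ + a₁ + a₂
  ... | no a₃≢v₃ = inj₁ (many-insert (sum-one a₃∈)
      (many-eight (>⇒≢ a₁<a₃ , p₁) (>⇒≢ a₂<a₃ , p₂) (a₃≢v₃ , p₃) (<⇒≢ a₃<v₄ , p₄) (<⇒≢ a₃<v₅ , p₅)
        (<⇒≢ a₃<v₆ , p₆) (<⇒≢ a₃<v₇ , p₇) (<⇒≢ (<-trans a₃<v₇ v₇<v₈) , p₈)))
    where
    a₃<v₄ : a₃ < a₁ + a₁ + a₃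
    a₃<v₄ = <-two-+ a₁>0
    a₃<v₅ : a₃ < a₂ + a₂ + a₃
    a₃<v₅ = <-trans a₃<v₄ v₄<v₅
    a₃<v₆ : a₃ < a₃ + a₃ + a₂
    a₃<v₆ = <-trans a₃<v₅ v₅<v₆
    a₃<v₇ : a₃ < a₃ + a₃ + (a₁ + a₁ + a₂)
    a₃<v₇ = <-trans a₃<v₆ v₆<v₇
  ... | yes a₃≡v₃ with a₂ + a₂ + a₁ ℕ.≟ a₁ + a₁ + a₃
  ...   | yes e≡v₄ = inj₂ (a₃≡v₃ , e≡v₄)
  ...   | no e≢v₄ = inj₁ (many-insert (sum-two-one a₂∈ a₁∈ (<⇒≢ a₁<a₂))
      (many-eight (>⇒≢ (<-trans a₁<a₂ a₂<e) , p₁) (>⇒≢ a₂<e , p₂) (>⇒≢ v₃<e , p₃) (e≢v₄ , p₄) (<⇒≢ e<v₅ , p₅)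
        (<⇒≢ e<v₆ , p₆) (<⇒≢ e<v₇ , p₇) (<⇒≢ (<-trans e<v₇ v₇<v₈) , p₈)))
    where
    v₃<e : a₁ + a₁ + a₂ < a₂ + a₂ + a₁
    v₃<e = double-swap-< a₁<a₂
    a₂<e : a₂ < a₂ + a₂ + a₁
    a₂<e = <-trans a₂<v₃ v₃<e
    e<v₅ : a₂ + a₂ + a₁ < a₂ + a₂ + a₃
    e<v₅ = +-monoʳ-< (a₂ + a₂) a₁<a₃
    e<v₆ : a₂ + a₂ + a₁ < a₃ + a₃ + a₂
    e<v₆ = <-trans e<v₅ v₅<v₆
    e<v₇ : a₂ + a₂ + a₁ < a₃ + a₃ + (a₁ + a₁ + a₂)
    e<v₇ = <-trans e<v₆ v₆<v₇

-- Four odd elements beginning c, 3c, 5c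

sum-scale : ∀ c → Sum j s xs → Sum j (s * c) (map (_* c) xs)
sum-scale c nil = nil
sum-scale {xs = x ∷ _} c (add {s = s} d p e refl) = add d (sum-scale c p) e (mult-scale d)
  where
  mult-scale : ∀ d → mult d (x * c) + s * c ≡ (mult d x + s) * c
  mult-scale neg = refl
  mult-scale zer = sym (*-distribʳ-+ c x s)
  mult-scale pos = sym (≡-trans (*-distribʳ-+ c (x + x) s) (cong (_+ s * c) (*-distribʳ-+ c x x)))

-- Up to scaling, the case where the fourth element is 7c: every odd number up to 31 occurs.
many-1357 : Many 16 (λ s → Sum 1 s (7 ∷ 5 ∷ 3 ∷ 1 ∷ []))
many-1357 = l , toWitness {a? = unique? l} tt ,
  (skip (skip (skip (one nil)))) ∷
  (skip (skip (one (skip nil)))) ∷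
  (skip (skip (one (two nil)))) ∷
  (skip (skip (two (one nil)))) ∷
  (one (skip (skip (two nil)))) ∷
  (skip (one (two (skip nil)))) ∷
  (skip (one (two (two nil)))) ∷
  (skip (two (one (two nil)))) ∷
  (skip (two (two (one nil)))) ∷
  (one (two (skip (two nil)))) ∷
  (two (skip (two (one nil)))) ∷
  (one (two (two (skip nil)))) ∷
  (one (two (two (two nil)))) ∷
  (two (one (two (two nil)))) ∷
  (two (two (one (two nil)))) ∷
  (two (two (two (one nil)))) ∷
  [] , refl
  where
  open import Data.List.Relation.Unary.Unique.DecPropositional ℕ._≟_ using (unique?)
  l : List ℕ
  l = 1 ∷ 3 ∷ 5 ∷ 7 ∷ 9 ∷ 11 ∷ 13 ∷ 15 ∷ 17 ∷ 19 ∷ 21 ∷ 23 ∷ 25 ∷ 27 ∷ 29 ∷ 31 ∷ []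

par-* : Odd k → ∀ n → par (n * k) ≡ par n
par-* odd zero = refl
par-* {k} odd (suc n) = ≡-trans (par-+ k (n * k)) (cong₂ _xor_ odd (par-* {k} odd n))

module Exceptional {c x} (c>0 : 0 < c) (odd-c : Odd c) (5c<x : 5 * c < x) (odd-x : Odd x) where

  c< : ∀ m n → {True (m ℕ.<? n)} → m * c < n * c
  c< m n {m<n} = *-monoˡ-< c {{ℕ.>-nonZero c>0}} (toWitness m<n)

  3c<x : 3 * c < x
  3c<x = <-trans (c< 3 5) 5c<x

  1c<x : 1 * c < x
  1c<x = <-trans (c< 1 5) 5c<x

  open OddStep {x} {1 * c} {3 * c} {5 * c} {[]}
    ((5c<x ∷ 3c<x ∷ 1c<x ∷ []) ∷ (c< 3 5 ∷ c< 1 5 ∷ []) ∷ (c< 1 3 ∷ []) ∷ [] ∷ [])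
    (≤-<-trans z≤n 5c<x ∷ c< 0 5 ∷ c< 0 3 ∷ c< 0 1 ∷ [])
    (odd-x ∷ par-* {c} odd-c 5 ∷ par-* {c} odd-c 3 ∷ par-* {c} odd-c 1 ∷ [])

  1+1+1 : ∀ c → 1 * c + 1 * c + 1 * c ≡ 3 * c
  1+1+1 = solve-∀

  1+1+3 : ∀ c → 1 * c + 1 * c + 3 * c ≡ 5 * c
  1+1+3 = solve-∀

  1+1+5 : ∀ c → 1 * c + 1 * c + 5 * c ≡ 7 * c
  1+1+5 = solve-∀

  1+1+7 : ∀ c → 1 * c + 1 * c + 7 * c ≡ 9 * c
  1+1+7 = solve-∀

  3+3+1 : ∀ c → 3 * c + 3 * c + 1 * c ≡ 7 * c
  3+3+1 = solve-∀

  5+5+1 : ∀ c → 5 * c + 5 * c + 1 * c ≡ 11 * c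
  5+5+1 = solve-∀

  7+7+1 : ∀ c → 7 * c + 7 * c + 1 * c ≡ 15 * c
  7+7+1 = solve-∀

  5+5+1+1+3 : ∀ c → 5 * c + 5 * c + (1 * c + 1 * c + 3 * c) ≡ 15 * c
  5+5+1+1+3 = solve-∀

  other-3c : Other (3 * c)
  other-3c = subst Other (1+1+1 c) (flip-same (there a₁∈) same-a₁)

  -- The elements c, 3c, 5c give only eight values and the step adds seven, one short of 16. The
  -- values of `others` are among 3c, 5c, 7c, 11c, so a further low value in the other class need
  -- only avoid these.
  with-extra : ∀ {e} → LowOther e → e ≢ 3 * c → e ≢ 5 * c → e ≢ 7 * c → e ≢ 11 * c → Many 16 (λ s → Sum 1 s all)
  with-extra {e} pe ≢3c ≢5c ≢7c ≢11c = assemble-next other-3c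
    (many-insert pe (many-weaken (λ (low , origin) → avoid origin , low) others))
    (Three.eight (c< 0 1) (c< 1 3) (c< 3 5))
    where
    avoid : ∀ {s} → s ≡ 3 * c ⊎ s ≡ 1 * c + 1 * c + 3 * c ⊎ Doubled (1 * c) s → e ≢ s
    avoid (inj₁ refl) = ≢3c
    avoid (inj₂ (inj₁ refl)) e≡ = ≢5c (≡-trans e≡ (1+1+3 c))
    avoid (inj₂ (inj₂ (_ , here refl , _ , refl))) e≡ = ≢11c (≡-trans e≡ (5+5+1 c))
    avoid (inj₂ (inj₂ (_ , there (here refl) , _ , refl))) e≡ = ≢7c (≡-trans e≡ (3+3+1 c))
    avoid (inj₂ (inj₂ (_ , there (there (here refl)) , a₁≢ , _))) _ = a₁≢ refl

  sixteen : Many 16 (λ s → Sum 1 s all)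
  sixteen with <-cmp x (7 * c)
  ... | tri≈ _ refl _ = many-map (_* c) (λ {x} {y} _ _ → *-cancelʳ-≡ x y c {{ℕ.>-nonZero c>0}}) (sum-scale c) many-1357
  -- The extra value is 15c, which is below 2x + c exactly when 7c < x.
  ... | tri> _ _ 7c<x = with-extra
    ( ≤-<-trans (≤-reflexive (≡-trans (5+5+1+1+3 c) (sym (7+7+1 c)))) (double-< (1 * c) 7c<x)
    , flip-same (there a₃∈) (flip-other (there a₁∈) other-3c)
    , sum-two-two-one (there a₃∈) (there a₁∈) (there a₂∈) (<⇒≢ (c< 1 5)) (<⇒≢ (c< 3 5)) (>⇒≢ (c< 1 3)))
    (far 3) (far 5) (far 7) (far 11)
    where
    far : ∀ n → {True (n ℕ.<? 15)} → 5 * c + 5 * c + (1 * c + 1 * c + 3 * c) ≢ n * c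
    far n {n<15} eq = <⇒≢ (c< n 15 {n<15}) (≡-trans (sym eq) (5+5+1+1+3 c))
  -- The extra value is `x`, between 5c and 7c, or 2c + x, between 7c and 9c, whichever is in the
  -- other class.
  ... | tri< x<7c _ _ with same⊎other x
  ...   | inj₂ other-x = with-extra
    (<-≤-trans (m<m+n x (≤-<-trans z≤n 1c<x)) (m≤m+n (x + x) _) , other-x , sum-one (here refl))
    (>⇒≢ 3c<x) (>⇒≢ 5c<x) (<⇒≢ x<7c) (<⇒≢ (<-trans x<7c (c< 7 11)))
  ...   | inj₁ same-x = with-extra
    (double-swap-< 1c<x , flip-same (there a₁∈) same-x , sum-two-one (there a₁∈) (here refl) (>⇒≢ 1c<x))
    (>⇒≢ (<-trans (c< 3 7) 7c<e)) (>⇒≢ (<-trans (c< 5 7) 7c<e)) (>⇒≢ 7c<e) (<⇒≢ (<-trans e<9c (c< 9 11)))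
    where
    7c<e : 7 * c < 1 * c + 1 * c + x
    7c<e = ≤-<-trans (≤-reflexive (sym (1+1+5 c))) (+-monoʳ-< (1 * c + 1 * c) 5c<x)
    e<9c : 1 * c + 1 * c + x < 9 * c
    e<9c = <-≤-trans (+-monoʳ-< (1 * c + 1 * c) x<7c) (≤-reflexive (1+1+7 c))

-- The lower bound for shifted sums

-- Removing the largest element repeatedly keeps the three least ones fixed. The induction therefore
-- stops at four elements, where either nine values grow by seven or the three least are c, 3c, 5c.
many-sum₁-odd-list : ∀ ms {x a₁ a₂ a₃} → Descending (x ∷ ms ++ a₃ ∷ a₂ ∷ a₁ ∷ []) →
  All (0 <_) (x ∷ ms ++ a₃ ∷ a₂ ∷ a₁ ∷ []) → All Odd (x ∷ ms ++ a₃ ∷ a₂ ∷ a₁ ∷ []) →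
  Many ((4 + length ms) * (4 + length ms)) (λ s → Sum 1 s (x ∷ ms ++ a₃ ∷ a₂ ∷ a₁ ∷ []))
many-sum₁-odd-list [] {x} {a₁} {a₂} {a₃}
  desc@((a₃<x ∷ _) ∷ (a₂<a₃ ∷ _) ∷ (a₁<a₂ ∷ _) ∷ _)
  positive@(_ ∷ _ ∷ _ ∷ a₁>0 ∷ []) odds@(odd-x ∷ _ ∷ _ ∷ odd-a₁ ∷ [])
  with Three.nine-or-exceptional a₁>0 a₁<a₂ a₂<a₃
... | inj₁ nine = OddStep.many-step {ms = []} desc positive odds nine
... | inj₂ (a₃≡ , eq) = subst (λ xs → Many 16 (λ s → Sum 1 s xs))
    (cong₂ (λ u v → x ∷ u ∷ v) (sym a₃≡5a₁) (cong₂ (λ u v → u ∷ v ∷ []) (sym a₂≡3a₁) (*-identityˡ a₁)))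
    (Exceptional.sixteen a₁>0 odd-a₁ (subst (_< x) a₃≡5a₁ a₃<x) odd-x)
  where
  open ≡-Reasoning
  rotate : ∀ a b → a + b + b ≡ b + b + a
  rotate = solve-∀
  collect₃ : ∀ a b → a + a + (a + a + b) ≡ a + b + 3 * a
  collect₃ = solve-∀
  collect₅ : ∀ a → a + a + 3 * a ≡ 5 * a
  collect₅ = solve-∀
  a₂≡3a₁ : a₂ ≡ 3 * a₁
  a₂≡3a₁ = +-cancelˡ-≡ (a₁ + a₂) _ _ (begin
    a₁ + a₂ + a₂              ≡⟨ rotate a₁ a₂ ⟩
    a₂ + a₂ + a₁              ≡⟨ eq ⟩
    a₁ + a₁ + a₃              ≡⟨ cong (a₁ + a₁ +_) a₃≡ ⟩
    a₁ + a₁ + (a₁ + a₁ + a₂)  ≡⟨ collect₃ a₁ a₂ ⟩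
    a₁ + a₂ + 3 * a₁          ∎)
  a₃≡5a₁ : a₃ ≡ 5 * a₁
  a₃≡5a₁ = ≡-trans a₃≡ (≡-trans (cong (a₁ + a₁ +_) a₂≡3a₁) (collect₅ a₁))
many-sum₁-odd-list (y ∷ ms) desc@(_ ∷ desc′) positive@(_ ∷ positive′) odds@(_ ∷ odds′) =
  many-cast (count (length ms))
    (OddStep.many-step {ms = y ∷ ms} desc positive odds (many-sum₁-odd-list ms desc′ positive′ odds′))
  where
  count : ∀ n → 4 + n + (5 + n + (4 + n) * (4 + n)) ≡ (5 + n) * (5 + n)
  count = solve-∀

last-three : (xs : List ℕ) → ∀ {n} → length xs ≡ 3 + n →
  ∃ λ ms → ∃ λ a₃ → ∃ λ a₂ → ∃ λ a₁ → xs ≡ ms ++ a₃ ∷ a₂ ∷ a₁ ∷ [] × length ms ≡ n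
last-three (a₃ ∷ a₂ ∷ a₁ ∷ []) {zero} refl = [] , a₃ , a₂ , a₁ , refl , refl
last-three (x ∷ xs) {suc n} e with ms , a₃ , a₂ , a₁ , refl , e′ ← last-three xs (suc-injective e) =
  x ∷ ms , a₃ , a₂ , a₁ , refl , cong suc e′

sum-halve : All Even xs → sum (halve xs) + sum (halve xs) ≡ sum xs
sum-halve [] = refl
sum-halve {x ∷ xs} (even ∷ evens) =
  ≡-trans (ℕ-Semigroup.interchange ⌊ x /2⌋ (sum (halve xs)) ⌊ x /2⌋ (sum (halve xs)))
    (cong₂ _+_ (half-double x even) (sum-halve evens))

ofParity-none : ∀ b xs → ofParity b xs ≡ [] → All (λ x → par x ≡ not b) xs
ofParity-none b [] _ = []
ofParity-none b (x ∷ xs) e with hasParity? b x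
... | no ¬par = ¬-not ¬par ∷ ofParity-none b xs e

many-sum₁-odd : Descending xs → All (0 <_) xs → All Odd xs → length xs ≡ 4 + k →
  Many ((4 + k) * (4 + k)) (λ s → Sum 1 s xs)
many-sum₁-odd {x ∷ xs} {k} desc positive odds e
  with ms , a₃ , a₂ , a₁ , refl , refl ← last-three xs {k} (suc-injective e) = many-sum₁-odd-list ms desc positive odds

-- The bound n on the sum is for termination: halving decreases the sum.
many-sum₁ : ∀ n → sum xs ≤ n → Descending xs → All (0 <_) xs → length xs ≡ 4 + k →
  Many ((4 + k) * (4 + k)) (λ s → Sum 1 s xs)
many-sum₁ {xs} n sum≤ desc positive e with ofParity true xs in odd≡ | ofParity false xs in even≡
... | _ ∷ _ | _ ∷ _ = many-sum₁-mixed desc positive e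
  (λ eq → case ≡-trans (sym odd≡) eq of λ ()) (λ eq → case ≡-trans (sym even≡) eq of λ ())
... | _ | [] = many-sum₁-odd desc positive (ofParity-none false xs even≡) e
... | [] | _ = all-even n sum≤
  where
  evens : All Even xs
  evens = ofParity-none true xs odd≡
  half>0 : ∀ {ys k} → All (0 <_) ys → length ys ≡ suc k → 0 < sum ys
  half>0 (y>0 ∷ _) _ = <-≤-trans y>0 (m≤m+n _ _)
  length-halve : length (halve xs) ≡ 4 + _
  length-halve = ≡-trans (length-map ⌊_/2⌋ xs) e
  σ = sum (halve xs)
  half< : σ < sum xs
  half< = <-≤-trans (m<m+n σ (half>0 (halve-positive evens positive) length-halve)) (≤-reflexive (sum-halve evens))
  all-even : ∀ n → sum xs ≤ n → Many _ (λ s → Sum 1 s xs)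
  all-even zero sum≤0 = contradiction (<-≤-trans half< sum≤0) λ ()
  all-even (suc n) sum≤ = many-map (λ s → s + s) (λ _ _ → double-injective) (halve-sum evens)
    (many-sum₁ n (s≤s⁻¹ (<-≤-trans half< sum≤)) (halve-descending evens desc) (halve-positive evens positive) length-halve)

-- Each step drops the largest element and a coefficient 1 and accounts for 2h values. `h` stays
-- fixed, so the base has h + 1 ≥ 4 elements, and (h + 1)² is the claimed count there.
many-sum : ∀ j → 3 ≤ h → Descending xs → All (0 <_) xs → length xs ≡ h + suc j →
  Many (h * h + 2 * h * suc j + 1) (λ s → Sum (suc j) s xs)
many-sum {suc zero} zero (s≤s ())
many-sum {suc (suc zero)} zero (s≤s (s≤s ()))
many-sum {suc (suc (suc h))} zero (s≤s (s≤s (s≤s _))) desc positive e =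
  many-cast (count h) (many-sum₁ _ ≤-refl desc positive (≡-trans e (+-comm (3 + h) 1)))
  where
  count : ∀ h → (4 + h) * (4 + h) ≡ (3 + h) * (3 + h) + 2 * (3 + h) * 1 + 1
  count = solve-∀
many-sum {h} {x ∷ xs} (suc j) 3≤h desc@(_ ∷ desc′) (_ ∷ positive) e =
  many-cast (count h j) (many-sum-step desc (sym e′) (many-sum j 3≤h desc′ positive e′))
  where
  e′ : length xs ≡ h + suc j
  e′ = suc-injective (≡-trans e (+-suc h (suc j)))
  count : ∀ h j → h + (h * h + 2 * h * suc j + 1 + h) ≡ h * h + 2 * h * suc (suc j) + 1
  count = solve-∀

-- Return to signed sums of integers

∈-allCoefs : ∀ {k} (v : Vec Coef k) → v ∈ allCoefs k
∈-allCoefs [] = here refl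
∈-allCoefs (c ∷ v) = ∈-concatMap⁺ (λ v → (neg ∷ v) ∷ (zer ∷ v) ∷ (pos ∷ v) ∷ [])
  (Any.map (λ { refl → choose c }) (∈-allCoefs v))
  where
  choose : ∀ c → c ∷ v ∈ (neg ∷ v) ∷ (zer ∷ v) ∷ (pos ∷ v) ∷ []
  choose neg = here refl
  choose zer = there (here refl)
  choose pos = there (there (here refl))

∣toList∣ : Vec ℤ k → List ℕ
∣toList∣ A = map ∣_∣ (toList A)

-- Adding |a| turns λa into (1 + λ sgn a)|a|, so for negative `a` the coefficients `neg` and `pos`
-- change places; `ones c` is 1 exactly where λ is 0.
sign-coef : ∀ c a → ∃ λ d → absCoef d + ones c ≡ 1 × coefℤ d ℤ.* a ℤ.+ ℤ.+ ∣ a ∣ ≡ ℤ.+ mult c ∣ a ∣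
sign-coef neg (ℤ.+ n) = neg , refl , ≡-trans (cong (ℤ._+ ℤ.+ n) (ℤₚ.-1*i≡-i (ℤ.+ n))) (ℤₚ.+-inverseˡ (ℤ.+ n))
sign-coef zer (ℤ.+ n) = zer , refl , refl
sign-coef pos (ℤ.+ n) = pos , refl , cong (ℤ._+ ℤ.+ n) (ℤₚ.*-identityˡ (ℤ.+ n))
sign-coef neg ℤ.-[1+ n ] = pos , refl ,
  ≡-trans (cong (ℤ._+ ℤ.+ suc n) (ℤₚ.*-identityˡ ℤ.-[1+ n ])) (ℤₚ.+-inverseˡ (ℤ.+ suc n))
sign-coef zer ℤ.-[1+ n ] = zer , refl , refl
sign-coef pos ℤ.-[1+ n ] = neg , refl , cong (ℤ._+ ℤ.+ suc n) (ℤₚ.-1*i≡-i ℤ.-[1+ n ])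

sum⇒combo : (A : Vec ℤ k) → Sum j s (∣toList∣ A) →
  ∃ λ (v : Vec Coef k) → weight v + j ≡ k × combo v A ℤ.+ ℤ.+ sum (∣toList∣ A) ≡ ℤ.+ s
sum⇒combo [] nil = [] , refl , refl
sum⇒combo (a ∷ A) (add {j = j} {s = s} c p refl refl)
  with v , ev , eqv ← sum⇒combo A p | d , ed , eqd ← sign-coef c a =
  d ∷ v , ≡-trans (ℕ-Semigroup.interchange (absCoef d) (weight v) (ones c) j) (cong₂ _+_ ed ev) ,
  ≡-trans (ℤ-Semigroup.interchange (coefℤ d ℤ.* a) (combo v A) (ℤ.+ ∣ a ∣) (ℤ.+ sum (∣toList∣ A))) (cong₂ ℤ._+_ eqd eqv)

sum⇒∈ : (A : Vec ℤ k) → h + j ≡ k → Sum j s (∣toList∣ A) →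
  ℤ.+ s ℤ.- ℤ.+ sum (∣toList∣ A) ∈ restrictedSignedSumset h A
sum⇒∈ {k} {h} {j} {s} A e p with v , ev , eqv ← sum⇒combo A p =
  ∈-map∘filter⁺ (λ v → combo v A) (λ v → weight v ℕ.≟ h)
    (v , ∈-allCoefs v , shifted , +-cancelʳ-≡ j (weight v) h (≡-trans ev (sym e)))
  where
  σ = ℤ.+ sum (∣toList∣ A)
  shifted : ℤ.+ s ℤ.- σ ≡ combo v A
  shifted = ≡-trans (cong (ℤ._- σ) (sym eqv)) (ℤ-Group.//-rightDividesʳ σ (combo v A))

card-≥ : ∀ {L} σ → Many n (λ s → ℤ.+ s ℤ.- σ ∈ L) → n ≤ card L
card-≥ {L = L} σ (l , u , all∈ , refl) = begin
  length l                                 ≡⟨ length-map (λ s → ℤ.+ s ℤ.- σ) l ⟨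
  length (map (λ s → ℤ.+ s ℤ.- σ) l)       ≤⟨ unique-⊆⇒length≤ (Uniqueₚ.map⁺ injective u) ⊆ ⟩
  card L                                   ∎
  where
  open ≤-Reasoning
  injective : ∀ {s t} → ℤ.+ s ℤ.- σ ≡ ℤ.+ t ℤ.- σ → s ≡ t
  injective eq = ℤₚ.+-injective (ℤ-Group.∙-cancelʳ (ℤ.- σ) _ _ eq)
  ⊆ : ∀ {z} → z ∈ map (λ s → ℤ.+ s ℤ.- σ) l → z ∈ deduplicate ℤ._≟_ L
  ⊆ z∈ with s , s∈ , refl ← ∈-map⁻ (λ s → ℤ.+ s ℤ.- σ) z∈ = ∈-deduplicate⁺ ℤ._≟_ (All.lookup all∈ s∈)

card-≤ : ∀ {L} ys → (∀ {z} → z ∈ L → z ∈ ys) → card L ≤ length ys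
card-≤ {L} ys L⊆ys = unique-⊆⇒length≤ (deduplicate-! ℤ._≟_ L) (λ z∈ → L⊆ys (∈-deduplicate⁻ ℤ._≟_ L z∈))

∣i∣≡∣j∣⇒i≡±j : ∀ i j → ∣ i ∣ ≡ ∣ j ∣ → i ≡ j ⊎ j ≡ ℤ.- i
∣i∣≡∣j∣⇒i≡±j (ℤ.+ m) (ℤ.+ n) refl = inj₁ refl
∣i∣≡∣j∣⇒i≡±j (ℤ.+ suc m) ℤ.-[1+ n ] refl = inj₂ refl
∣i∣≡∣j∣⇒i≡±j ℤ.-[1+ m ] (ℤ.+ suc n) refl = inj₂ refl
∣i∣≡∣j∣⇒i≡±j ℤ.-[1+ m ] ℤ.-[1+ n ] refl = inj₁ refl

-- Integers of equal absolute value are equal or opposite; distinctness excludes the first case and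
-- disjointness from -A the second.
∣∣-unique : ∀ {is} → Unique is → (∀ i → i ∈ is → ℤ.- i ∉ is) → Unique (map ∣_∣ is)
∣∣-unique [] _ = []
∣∣-unique {i ∷ is} (i∉ ∷ u) antisym =
  Allₚ.map⁺ (All.tabulate distinct) ∷ ∣∣-unique u (λ j j∈ -j∈ → antisym j (there j∈) (there -j∈))
  where
  distinct : ∀ {j} → j ∈ is → ∣ i ∣ ≢ ∣ j ∣
  distinct {j} j∈ eq with ∣i∣≡∣j∣⇒i≡±j i j eq
  ... | inj₁ i≡j = All.lookup i∉ j∈ i≡j
  ... | inj₂ refl = antisym i (here refl) (there j∈)

-- Zero would be its own negative.
∣∣-positive : ∀ {is} → (∀ i → i ∈ is → ℤ.- i ∉ is) → All (0 <_) (map ∣_∣ is)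
∣∣-positive antisym = Allₚ.map⁺ (All.tabulate (λ {i} i∈ → n≢0⇒n>0 λ ∣i∣≡0 →
  let i≡0 = ℤₚ.∣i∣≡0⇒i≡0 ∣i∣≡0 in antisym i i∈ (subst (_∈ _) (≡-trans i≡0 (cong ℤ.-_ (sym i≡0))) i∈)))

sort-descending : Unique xs → Descending (sort xs)
sort-descending {xs} u = AllPairs.zipWith (λ (x≥y , x≢y) → ≤∧≢⇒< x≥y (x≢y ∘ sym))
  (Linked⇒AllPairs (λ x≥y y≥z → ≤-trans y≥z x≥y) (sort-↗ xs) ,
   ↭ₛ.Unique-resp-↭ (setoid ℕ) (↭⇒↭ₛ (↭-sym (sort-↭ xs))) u)

-- With k = h + 1 + j, 2hk contains h² twice, so the truncated subtraction is exact.
bound : ∀ h j → 2 * h * (h + 1 + j) ∸ h * h + 1 ≡ h * h + 2 * h * suc j + 1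
bound h j = cong (_+ 1) (≡-trans (cong (_∸ h * h) (expand h j)) (m+n∸n≡m (h * h + 2 * h * suc j) (h * h)))
  where
  expand : ∀ h j → 2 * h * (h + 1 + j) ≡ h * h + 2 * h * suc j + h * h
  expand = solve-∀

lower-bound : (h k : ℕ) → 3 ≤ h → h + 1 ≤ k → (A : Vec ℤ k) → Distinct A → DisjointFromNeg A →
  card (restrictedSignedSumset h A) ≥ 2 * h * k ∸ h * h + 1
lower-bound h k 3≤h h<k A distinct disjoint with j , refl ← m≤n⇒∃[o]m+o≡n h<k =
  subst (_≤ card (restrictedSignedSumset h A)) (sym (bound h j))
    (card-≥ (ℤ.+ sum (∣toList∣ A)) (many-weaken (sum⇒∈ A (sym (+-assoc h 1 j)) ∘ sum-↭ (sort-↭ ∣A∣))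
      (many-sum j 3≤h (sort-descending (∣∣-unique distinct disjoint))
        (All-resp-↭ (↭-sym (sort-↭ ∣A∣)) (∣∣-positive disjoint)) length-sort)))
  where
  ∣A∣ = ∣toList∣ A
  length-sort : length (sort ∣A∣) ≡ h + suc j
  length-sort = ≡-trans (↭-length (sort-↭ ∣A∣))
    (≡-trans (length-map ∣_∣ (toList A)) (≡-trans (length-toList A) (+-assoc h 1 j)))

-- Sharpness: the first k odd numbers

oddVec : ∀ k → Vec ℤ k
oddVec zero = []
oddVec (suc k) = ℤ.+ suc (k + k) ∷ oddVec k

-- The bound separates each new head from the tail, giving distinctness; positivity rules out
-- opposite elements.
oddVec-∈ : ∀ k {i} → i ∈ toList (oddVec k) → ∃ λ n → i ≡ ℤ.+ suc n × n < k + k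
oddVec-∈ (suc k) (here refl) = k + k , refl , s≤s (+-monoʳ-≤ k (n≤1+n k))
oddVec-∈ (suc k) (there i∈) with n , refl , n< ← oddVec-∈ k i∈ =
  n , refl , <-≤-trans n< (m≤n⇒m≤1+n (+-monoʳ-≤ k (n≤1+n k)))

oddVec-distinct : ∀ k → Distinct (oddVec k)
oddVec-distinct zero = []
oddVec-distinct (suc k) = All.tabulate ≢head ∷ oddVec-distinct k
  where
  ≢head : ∀ {i} → i ∈ toList (oddVec k) → ℤ.+ suc (k + k) ≢ i
  ≢head i∈ eq with n , refl , n< ← oddVec-∈ k i∈ = <⇒≢ n< (sym (suc-injective (ℤₚ.+-injective eq)))

oddVec-disjoint : ∀ k → DisjointFromNeg (oddVec k)
oddVec-disjoint k i i∈ -i∈ with n , refl , _ ← oddVec-∈ k i∈ with _ , () , _ ← oddVec-∈ k -i∈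

-- M = w (2 k - w) is the sum of the w largest odd numbers below 2 k.
oddVec-combo : (v : Vec Coef k) → ∃ λ M → ∃ λ q → M + weight v * weight v ≡ 2 * weight v * k × q ≤ M ×
  combo v (oddVec k) ℤ.+ ℤ.+ M ≡ ℤ.+ (q + q)
oddVec-combo [] = 0 , 0 , refl , z≤n , refl
oddVec-combo {suc k} (c ∷ v) with M , q , eM , q≤M , eq ← oddVec-combo v = go c
  where
  w = weight v
  γ = combo v (oddVec k)
  a = suc (k + k)
  -- When k grows by one, w (2k - w) grows by `a` = 2k + 1 if the new element is used, as w then
  -- grows too, and by 2w if it is not.
  used : M + a + suc w * suc w ≡ 2 * suc w * suc k
  used = ≡-trans (split M k w) (≡-trans (cong (_+ 2 * (k + suc w)) eM) (merge k w))
    where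
    split : ∀ M k w → M + suc (k + k) + suc w * suc w ≡ M + w * w + 2 * (k + suc w)
    split = solve-∀
    merge : ∀ k w → 2 * w * k + 2 * (k + suc w) ≡ 2 * suc w * suc k
    merge = solve-∀
  unused : M + (w + w) + w * w ≡ 2 * w * suc k
  unused = ≡-trans (split M w) (≡-trans (cong (_+ (w + w)) eM) (merge k w))
    where
    split : ∀ M w → M + (w + w) + w * w ≡ M + w * w + (w + w)
    split = solve-∀
    merge : ∀ k w → 2 * w * k + (w + w) ≡ 2 * w * suc k
    merge = solve-∀
  ℤ-neg : ∀ a c M → ℤ.-1ℤ ℤ.* a ℤ.+ c ℤ.+ (M ℤ.+ a) ≡ c ℤ.+ M
  ℤ-neg = ℤ-solve-∀
  ℤ-zer : ∀ a c M w → ℤ.0ℤ ℤ.* a ℤ.+ c ℤ.+ (M ℤ.+ w) ≡ c ℤ.+ M ℤ.+ w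
  ℤ-zer = ℤ-solve-∀
  ℤ-pos : ∀ a c M → ℤ.1ℤ ℤ.* a ℤ.+ c ℤ.+ (M ℤ.+ a) ≡ c ℤ.+ M ℤ.+ (a ℤ.+ a)
  ℤ-pos = ℤ-solve-∀
  go : ∀ c → ∃ λ M → ∃ λ q → M + (absCoef c + w) * (absCoef c + w) ≡ 2 * (absCoef c + w) * suc k × q ≤ M ×
    coefℤ c ℤ.* ℤ.+ a ℤ.+ γ ℤ.+ ℤ.+ M ≡ ℤ.+ (q + q)
  go neg = M + a , q , used , ≤-trans q≤M (m≤m+n M a) , ≡-trans (ℤ-neg (ℤ.+ a) γ (ℤ.+ M)) eq
  go zer = M + (w + w) , q + w , unused , +-mono-≤ q≤M (m≤m+n w w) ,
    ≡-trans (ℤ-zer (ℤ.+ a) γ (ℤ.+ M) (ℤ.+ (w + w)))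
      (≡-trans (cong (ℤ._+ ℤ.+ (w + w)) eq) (cong ℤ.+_ (ℕ-Semigroup.interchange q q w w)))
  go pos = M + a , q + a , used , +-monoˡ-≤ a q≤M ,
    ≡-trans (ℤ-pos (ℤ.+ a) γ (ℤ.+ M))
      (≡-trans (cong (ℤ._+ ℤ.+ (a + a)) eq) (cong ℤ.+_ (ℕ-Semigroup.interchange q q a a)))

-- Every signed sum is 2q - M with 0 ≤ q ≤ M: it lies between -M and M and has the parity of M,
-- which leaves M + 1 values.
upper-bound : ∀ h k → card (restrictedSignedSumset h (oddVec k)) ≤ 2 * h * k ∸ h * h + 1
upper-bound h k = ≤-trans (card-≤ (map value (upTo (suc M))) ⊆)
  (≤-reflexive (≡-trans (length-map value (upTo (suc M))) (≡-trans (length-upTo (suc M)) (+-comm 1 M))))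
  where
  M = 2 * h * k ∸ h * h
  value : ℕ → ℤ
  value q = ℤ.+ (q + q) ℤ.- ℤ.+ M
  ⊆ : ∀ {z} → z ∈ restrictedSignedSumset h (oddVec k) → z ∈ map value (upTo (suc M))
  ⊆ z∈ with v , _ , refl , refl ← ∈-map∘filter⁻ (λ v → combo v (oddVec k)) (λ v → weight v ℕ.≟ h) {xs = allCoefs k} z∈
    with M′ , q , eM , q≤M , eq ← oddVec-combo v =
    subst (_∈ map value (upTo (suc M))) shifted (∈-map⁺ value (∈-upTo⁺ (s≤s (subst (q ≤_) M′≡M q≤M))))
    where
    γ = combo v (oddVec k)
    M′≡M : M′ ≡ M
    M′≡M = ≡-trans (sym (m+n∸n≡m M′ (h * h))) (cong (_∸ h * h) eM)
    shifted : value q ≡ γ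
    shifted = ≡-trans (cong (ℤ._- ℤ.+ M) (≡-trans (sym eq) (cong (λ M → γ ℤ.+ ℤ.+ M) M′≡M)))
      (ℤ-Group.//-rightDividesʳ (ℤ.+ M) γ)

theorem3 : (h k : ℕ) → 3 ≤ h → h + 1 ≤ k →
    ((A : Vec ℤ k) → Distinct A → DisjointFromNeg A →
    card (restrictedSignedSumset h A) ≥ 2 * h * k ∸ h * h + 1)
    × Σ (Vec ℤ k) (λ A → Distinct A × DisjointFromNeg A ×
    (card (restrictedSignedSumset h A) ≡ 2 * h * k ∸ h * h + 1))
theorem3 h k 3≤h h<k =
  lower-bound h k 3≤h h<k ,
  oddVec k , oddVec-distinct k , oddVec-disjoint k ,
  ≤-antisym (upper-bound h k) (lower-bound h k 3≤h h<k (oddVec k) (oddVec-distinct k) (oddVec-disjoint k))
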